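{- Let $C_5^{3- }$ denote the $3$-graph on vertex set $\{1,2,3,4,5\}$ with edge set $\{\{1,2,3\},\{2,3,4\},\{3,4,5\},\{4,5,1\}\}$. Then the Turán density of $C_5^{3- }$ satisfies $$\pi(C_5^{3- })=\lim_{n\to\infty}\frac{\mathrm{ex}(n,C_5^{3- })}{\binom{n}{3}}=\frac14.$$
   Context: A $3$-graph is a collection of $3$-element subsets (edges) of a vertex set. For a $3$-graph $F$, $\mathrm{ex}(n,F)$ is the maximum number of edges in an $n$-vertex $3$-graph containing no copy of $F$ as a (not necessarily induced) subgraph, and $\pi(F)=\lim_{n\to\infty}\mathrm{ex}(n,F)/\binom{n}{3}$ (this limit exists). -}

module Defs where

open import Data.Nat using (ℕ; zero; suc; _≤_)
open import Data.Nat.Combinatorics using (_C_)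
open import Data.Integer using (+_)
open import Data.Rational using (ℚ; _/_; 0ℚ; _-_; _<_) renaming (∣_∣ to abs)
open import Data.Fin using (Fin)
open import Data.Fin.Subset using (Subset; ⁅_⁆; _∪_; ∣_∣)
open import Data.List using (List; _∷_; []; length)
open import Data.List.Membership.Propositional using (_∈_)
open import Data.List.Relation.Unary.All using (All)
open import Data.List.Relation.Unary.Unique.Propositional using (Unique)
open import Data.Product using (Σ; _×_; ∃; ∃-syntax; _,_)
open import Function.Definitions using (Injective)
open import Relation.Binary.PropositionalEquality using (_≡_)
open import Relation.Nullary using (¬_)

record ThreeGraph (n : ℕ) : Set where
  field
    edges    : List (Subset n)
    distinct : Unique edges
    size3    : All (λ e → ∣ e ∣ ≡ 3) edges
open ThreeGraph public

e : ∀ {n} → ThreeGraph n → ℕ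
e G = length (edges G)

triple : ∀ {n} → Fin n → Fin n → Fin n → Subset n
triple a b c = ⁅ a ⁆ ∪ (⁅ b ⁆ ∪ ⁅ c ⁆)

Contains : ∀ {n k} → ThreeGraph n → List (Fin k × Fin k × Fin k) → Set
Contains {n} {k} G F =
  Σ (Fin k → Fin n) λ φ → (Injective _≡_ _≡_ φ ×
          All (λ { (a , b , c) → triple (φ a) (φ b) (φ c) ∈ edges G }) F)

-- C_5^{3-}: vertices {1,...,5} ↦ Fin 5 = {0,...,4};
-- edges {1,2,3},{2,3,4},{3,4,5},{4,5,1}.
C5minus : List (Fin 5 × Fin 5 × Fin 5)
C5minus = (0F , 1F , 2F) ∷ (1F , 2F , 3F) ∷ (2F , 3F , 4F) ∷ (3F , 4F , 0F) ∷ []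
  where open import Data.Fin using () renaming (zero to 0F)
        open import Data.Fin.Patterns using (1F; 2F; 3F; 4F)

IsEx : ∀ {k} → List (Fin k × Fin k × Fin k) → ℕ → ℕ → Set
IsEx F n m =
  (∃[ G ] (¬ Contains {n} G F × e G ≡ m)) ×
  (∀ (G : ThreeGraph n) → ¬ Contains G F → e G ≤ m)

-- a / d as a rational, with the (irrelevant) convention a / 0 = 0.
ratio : ℕ → ℕ → ℚ
ratio a zero    = 0ℚ
ratio a (suc d) = + a / suc d

ConvergesTo : (ℕ → ℚ) → ℚ → Set
ConvergesTo s L =
  ∀ (ε : ℚ) → 0ℚ < ε → ∃[ N ] (∀ n → N ≤ n → abs (s n - L) < ε)

{-# OPTIONS --safe #-}
module Submission where

-- Upper bound.  Call (q, r) linked at u if q and r have a common neighbour in the link graph of u.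
-- Every graph has at least as many linked ordered pairs as ordered edges: a vertex q is linked to at
-- least as many vertices as the average degree of its neighbours, and d(y)/d(q) + d(q)/d(y) ≥ 2 for
-- each edge qy.  On the other hand, two distinct vertices of a triple {u, q, r} at which the other
-- two are linked yield a C₅⁻ or a K₄⁻, and if uqr is itself an edge then one such vertex yields a
-- K₄⁻.  Were K₄⁻ absent, summing over u would give 6e ≤ 2 (C(n,3) − e) + n(n − 1), the last term
-- counting the pairs (q, q); hence e ≤ (n³ − n)/24.  A K₄⁻ may occur, but each triple is a triangle
-- in the link of at most one vertex, as two such vertices give a C₅⁻.  So one asks for at least k
-- common neighbours, which makes the edges of K₄⁻'s cost only O(n³/k).
--
-- Lower bound.  The iterated blow-up of an edge, encoded by base-3 digits.

open import Defs
import Algebra.Properties.Semiring.Sum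
open import Data.Bool using (Bool; true; false; T; _∨_; _∧_; not)
import Data.Bool.Properties as Bool
open import Data.Empty using (⊥; ⊥-elim)
open import Data.Fin using (Fin; zero; suc; toℕ)
import Data.Fin.Properties as Fin
open import Data.Fin.Subset using (Subset; ⁅_⁆; _∪_; ∣_∣; inside; outside; _-_)
  renaming (⊥ to ∅; _∈_ to _∈ₛ_; _∉_ to _∉ₛ_)
open import Data.Fin.Subset.Properties
  using (∪-identityˡ; ∪-identityʳ; ∪-idem; ∪-assoc; ∪-comm; p─⊥≡p; Empty-unique;
         x∈p∪q⁻; x∈p∪q⁺; x∈⁅x⁆; x∈⁅y⁆⇒x≡y; ∣⁅x⁆∣≡1)
import Data.Integer as ℤ
import Data.Integer.Properties as ℤ
open import Data.List using (List; []; _∷_; length; map; filter; deduplicate; cartesianProduct; allFin)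
import Data.List.Membership.DecPropositional as DecMembership
open import Data.List.Membership.Propositional using (_∈_)
open import Data.List.Membership.Propositional.Properties
  using (∈-map⁺; ∈-map⁻; ∈-filter⁺; ∈-filter⁻; ∈-cartesianProduct⁺; ∈-allFin;
         ∈-deduplicate⁺; ∈-deduplicate⁻)
open import Data.List.Relation.Unary.All as All using (All; []; _∷_)
open import Data.List.Relation.Unary.AllPairs using ([]; _∷_)
open import Data.List.Relation.Unary.Unique.Propositional using (Unique)
import Data.List.Relation.Unary.Unique.DecPropositional.Properties as DecUnique
open import Data.Nat as ℕ
  using (ℕ; zero; suc; _+_; _*_; _%_; _!; _≤_; _<_; z≤n; s≤s; s≤s⁻¹; _≤?_; _≤ᵇ_;
         NonZero; >-nonZero; >-nonZero⁻¹; ≢-nonZero⁻¹)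
open import Data.Nat.Combinatorics using (_C_; nC1≡n; nCk+nC[k+1]≡[n+1]C[k+1])
open import Data.Nat.Coprimality using (Coprime)
open import Data.Nat.Divisibility using (_∣_; m≤n⇒m!∣n!; ∣-trans; m∣m*n)
open import Data.Nat.DivMod
  using (_mod_; m/n*n≡m; /-monoʳ-≤; [m+kn]%n≡m%n; m<n⇒m%n≡m; +-distrib-/; m<n⇒m/n≡0; m*n/n≡m;
         m*n%n≡0; m≡m%n+[m/n]*n; m%n<n; m/n*n≤m; m/n<m)
open import Data.Nat.Properties hiding (_≟_)
open import Data.Nat.Tactic.RingSolver using (solve-∀)
open import Data.Product using (∃-syntax; _×_; _,_; proj₁; proj₂)
open import Data.Rational as ℚ using (mkℚ; toℚᵘ; _/_)
import Data.Rational.Properties as ℚ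
open import Data.Rational.Unnormalised as ℚᵘ using (mkℚᵘ; *<*)
import Data.Rational.Unnormalised.Properties as ℚᵘ
open import Data.Sum as Sum using (_⊎_; inj₁; inj₂)
open import Data.Vec as Vec using (_∷_; []; lookup)
import Data.Vec.Properties as VecP
import Data.Vec.Relation.Unary.All as V
import Data.Vec.Relation.Unary.AllPairs as VP
open import Data.Vec.Relation.Unary.Unique.Propositional.Properties using (lookup-injective)
open import Function using (_∘_; Equivalence)
open import Relation.Binary.Definitions using (DecidableEquality)
open import Relation.Binary.PropositionalEquality
  using (_≡_; _≢_; refl; sym; trans; cong; cong₂; subst; subst₂; ≢-sym; module ≡-Reasoning)
open import Relation.Nullary using (yes; no; ¬_; Dec; contradiction; does)
open import Relation.Nullary.Decidable using (from-yes; _→-dec_; ¬?; dec-true; dec-false)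

open Algebra.Properties.Semiring.Sum +-*-semiring
  using (sum; sum-syntax; sum-cong-≗; ∑-comm; ∑-distrib-+; *-distribˡ-sum; *-distribʳ-sum)

-- Linked pairs in a graph

⟦_⟧ : Bool → ℕ
⟦ true  ⟧ = 1
⟦ false ⟧ = 0

⟦⟧≤1 : ∀ b → ⟦ b ⟧ ≤ 1
⟦⟧≤1 true  = ≤-refl
⟦⟧≤1 false = z≤n

sum-mono-≤ : ∀ {n} {f g : Fin n → ℕ} → (∀ i → f i ≤ g i) → sum f ≤ sum g
sum-mono-≤ {zero}  f≤g = z≤n
sum-mono-≤ {suc n} f≤g = +-mono-≤ (f≤g zero) (sum-mono-≤ (f≤g ∘ suc))

sum-const : ∀ n c → ∑[ i < n ] c ≡ n * c
sum-const zero    c = refl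
sum-const (suc n) c = cong (c +_) (sum-const n c)

sum-bounded : ∀ {n c} {f : Fin n → ℕ} → (∀ i → f i ≤ c) → sum f ≤ n * c
sum-bounded {n} {c} f≤c = ≤-trans (sum-mono-≤ f≤c) (≤-reflexive (sum-const n c))

-- The two sides differ by the product of the two gaps, named `f` and `e` below.
rearrangement : ∀ {w w′ d d′} → w′ ≤ w → d ≤ d′ → w * d + w′ * d′ ≤ w * d′ + w′ * d
rearrangement {w} {w′} {d} {d′} w′≤w d≤d′
  with f , refl ← m≤n⇒∃[o]m+o≡n w′≤w | e , refl ← m≤n⇒∃[o]m+o≡n d≤d′ =
  ≤-trans (m≤m+n _ (f * e)) (≤-reflexive (lemma w′ f d e))
  where
  lemma : ∀ w f d e → (w + f) * d + w * (d + e) + f * e ≡ (w + f) * (d + e) + w * d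
  lemma = solve-∀

module _ {n : ℕ} (A : Fin n → Fin n → Bool) where

  degree : Fin n → ℕ
  degree q = ∑[ y < n ] ⟦ A q y ⟧

  codegree : Fin n → Fin n → ℕ
  codegree q r = ∑[ t < n ] (⟦ A q t ⟧ * ⟦ A t r ⟧)

  degree≤n : ∀ q → degree q ≤ n
  degree≤n q = ≤-trans (sum-bounded (⟦⟧≤1 ∘ A q)) (≤-reflexive (*-identityʳ n))

  codegree≤degree : ∀ q r → codegree q r ≤ degree q
  codegree≤degree q r = sum-mono-≤ λ t →
    ≤-trans (*-monoʳ-≤ ⟦ A q t ⟧ (⟦⟧≤1 (A t r))) (≤-reflexive (*-identityʳ _))

  -- Both sides count the walks of length two that start at `q`.
  ∑-codegree : ∀ q → ∑[ r < n ] codegree q r ≡ ∑[ y < n ] (⟦ A q y ⟧ * degree y)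
  ∑-codegree q = begin
    ∑[ r < n ] ∑[ y < n ] (⟦ A q y ⟧ * ⟦ A y r ⟧)   ≡⟨ ∑-comm (λ r y → ⟦ A q y ⟧ * ⟦ A y r ⟧) ⟩
    ∑[ y < n ] ∑[ r < n ] (⟦ A q y ⟧ * ⟦ A y r ⟧)
      ≡⟨ sum-cong-≗ (λ y → *-distribˡ-sum ⟦ A q y ⟧ (λ r → ⟦ A y r ⟧)) ⟨
    ∑[ y < n ] (⟦ A q y ⟧ * degree y)               ∎
    where open ≡-Reasoning

  linked : ℕ → Fin n → Fin n → Bool
  linked k q r = k ≤ᵇ codegree q r

  -- A linked pair is charged the whole degree bound `c`, an unlinked one less than `k`.
  codegree-split : ∀ k {c} q r → degree q ≤ c → codegree q r ≤ c * ⟦ linked k q r ⟧ + k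
  codegree-split k {c} q r d≤c with linked k q r in eq
  ... | true  = ≤-trans (codegree≤degree q r)
                  (≤-trans d≤c (≤-trans (≤-reflexive (sym (*-identityʳ c))) (m≤m+n _ k)))
  ... | false = ≤-trans (<⇒≤ (≰⇒> λ k≤ → subst T eq (≤⇒≤ᵇ k≤))) (m≤n+m k _)

  module _ (A-sym : ∀ x y → A x y ≡ A y x) (k m : ℕ) .{{_ : NonZero m}} where

    private
      -- Shifting the degrees by m bounds the weights 1/D of low-degree vertices by 1/m.
      D : Fin n → ℕ
      D q = degree q + m

      instance
        D≢0 : ∀ {q} → NonZero (D q)
        D≢0 {q} = >-nonZero (<-≤-trans (>-nonZero⁻¹ m) (m≤n+m m (degree q)))

      -- The factorial is a common multiple of all the `D q`, which lie between 1 and `n + m`. So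
      -- the weights `W q` = `N` / `D q` are exact and the argument stays in ℕ.
      N : ℕ
      N = (n + m) !

      D∣N : ∀ q → D q ∣ N
      D∣N q with D q in eq | +-monoˡ-≤ m (degree≤n q)
      ... | zero  | _   = contradiction eq (≢-nonZero⁻¹ (D q))
      ... | suc d | d<n = ∣-trans (m∣m*n (d !)) (m≤n⇒m!∣n! d<n)

      W : Fin n → ℕ
      W q = N ℕ./ D q

      W*D : ∀ q → W q * D q ≡ N
      W*D q = m/n*n≡m (D∣N q)

      -- d(y)/d(q) + d(q)/d(y) ≥ 2, with denominators cleared.
      exchange : ∀ q y → N + N ≤ W q * D y + W y * D q
      exchange q y with ≤-total (D q) (D y)
      ... | inj₁ q≤y = subst (_≤ W q * D y + W y * D q) (cong₂ _+_ (W*D q) (W*D y))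
                         (rearrangement (/-monoʳ-≤ N q≤y) q≤y)
      ... | inj₂ y≤q = subst₂ _≤_ (cong₂ _+_ (W*D y) (W*D q)) (+-comm (W y * D q) _)
                         (rearrangement (/-monoʳ-≤ N y≤q) y≤q)

      ∑A : (Fin n → Fin n → ℕ) → ℕ
      ∑A f = ∑[ q < n ] ∑[ y < n ] (⟦ A q y ⟧ * f q y)

      ∑A-flip : ∀ f → ∑A f ≡ ∑A λ q y → f y q
      ∑A-flip f = trans (∑-comm (λ q y → ⟦ A q y ⟧ * f q y))
        (sum-cong-≗ λ y → sum-cong-≗ λ q → cong (λ b → ⟦ b ⟧ * f q y) (A-sym q y))

      ∑A-+ : ∀ f g → ∑A (λ q y → f q y + g q y) ≡ ∑A f + ∑A g
      ∑A-+ f g = trans (sum-cong-≗ λ q → trans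
          (sum-cong-≗ λ y → *-distribˡ-+ ⟦ A q y ⟧ (f q y) (g q y))
          (∑-distrib-+ (λ y → ⟦ A q y ⟧ * f q y) (λ y → ⟦ A q y ⟧ * g q y)))
        (∑-distrib-+ (λ q → ∑[ y < n ] (⟦ A q y ⟧ * f q y)) (λ q → ∑[ y < n ] (⟦ A q y ⟧ * g q y)))

      ∑A-const : ∀ c → ∑A (λ _ _ → c) ≡ sum degree * c
      ∑A-const c = trans (sum-cong-≗ λ q → sym (*-distribʳ-sum c (λ y → ⟦ A q y ⟧)))
        (sym (*-distribʳ-sum c degree))

      ∑A-mono : ∀ {f g} → (∀ q y → f q y ≤ g q y) → ∑A f ≤ ∑A g
      ∑A-mono f≤g = sum-mono-≤ λ q → sum-mono-≤ λ y → *-monoʳ-≤ ⟦ A q y ⟧ (f≤g q y)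

      -- `S` / `N` is the sum of the ratios `D y` / `D q` over the ordered edges `q`, `y`.
      S : ℕ
      S = ∑A λ q y → W q * D y

      -- Reversing every edge leaves `S` unchanged, so `2 * S` contains both ratios of each ordered
      -- edge, and `exchange` bounds their sum.
      lower : sum degree * N ≤ S
      lower = *-cancelˡ-≤ 2 (begin
        2 * (sum degree * N)                     ≡⟨ double (sum degree) N ⟩
        sum degree * (N + N)                     ≡⟨ ∑A-const (N + N) ⟨
        ∑A (λ _ _ → N + N)                       ≤⟨ ∑A-mono exchange ⟩
        ∑A (λ q y → W q * D y + W y * D q)       ≡⟨ ∑A-+ (λ q y → W q * D y) (λ q y → W y * D q) ⟩
        S + ∑A (λ q y → W y * D q)               ≡⟨ cong (S +_) (∑A-flip λ q y → W q * D y) ⟨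
        S + S                                    ≡⟨ cong (S +_) (+-identityʳ S) ⟨
        2 * S                                    ∎)
        where
        open ≤-Reasoning
        double : ∀ a b → 2 * (a * b) ≡ a * (b + b)
        double = solve-∀

      -- The degrees of the neighbours of `q` add up to its codegrees, hence to at most `D q` per
      -- linked partner plus `n * k`. The weight `W q` then trades `D q` for `N`.
      row : ∀ q → m * (∑[ y < n ] (⟦ A q y ⟧ * (W q * D y))) ≤
                  N * (m * (∑[ r < n ] ⟦ linked k q r ⟧) + n * k + m * m)
      row q = begin
        m * (∑[ y < n ] (⟦ A q y ⟧ * (W q * D y)))
          ≡⟨ cong (m *_) (trans (sum-cong-≗ λ y → shuffle ⟦ A q y ⟧ (W q) (degree y) m)
               (sym (*-distribˡ-sum (W q) (λ y → ⟦ A q y ⟧ * degree y + ⟦ A q y ⟧ * m)))) ⟩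
        m * (W q * (∑[ y < n ] (⟦ A q y ⟧ * degree y + ⟦ A q y ⟧ * m)))
          ≡⟨ cong (λ z → m * (W q * z)) (trans
               (∑-distrib-+ (λ y → ⟦ A q y ⟧ * degree y) (λ y → ⟦ A q y ⟧ * m))
               (cong₂ _+_ (sym (∑-codegree q)) (sym (*-distribʳ-sum m (λ y → ⟦ A q y ⟧))))) ⟩
        m * (W q * (∑[ r < n ] codegree q r + degree q * m))
          ≤⟨ *-monoʳ-≤ m (*-monoʳ-≤ (W q) (+-mono-≤ codegrees (*-monoˡ-≤ m (m≤m+n (degree q) m)))) ⟩
        m * (W q * (D q * row-links + n * k + D q * m))
          ≡⟨ collect m (W q) (D q) row-links (n * k) ⟩
        (W q * D q) * (m * row-links + m * m) + (W q * m) * (n * k)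
          -- Here the shift pays off: `D q` is at least `m`, so `W q * m` is at most `N` even when
          -- the degree of `q` is small.
          ≤⟨ +-mono-≤ (≤-reflexive (cong (_* (m * row-links + m * m)) (W*D q))) (*-monoˡ-≤ (n * k)
               (≤-trans (*-monoʳ-≤ (W q) (m≤n+m m (degree q))) (≤-reflexive (W*D q)))) ⟩
        N * (m * row-links + m * m) + N * (n * k)
          ≡⟨ recollect N (m * row-links) (m * m) (n * k) ⟩
        N * (m * row-links + n * k + m * m) ∎
        where
        open ≤-Reasoning
        row-links : ℕ
        row-links = ∑[ r < n ] ⟦ linked k q r ⟧

        codegrees : ∑[ r < n ] codegree q r ≤ D q * row-links + n * k
        codegrees = begin
          ∑[ r < n ] codegree q r                       ≤⟨ sum-mono-≤ (λ r → codegree-split k q r (m≤m+n (degree q) m)) ⟩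
          ∑[ r < n ] (D q * ⟦ linked k q r ⟧ + k)       ≡⟨ ∑-distrib-+ (λ r → D q * ⟦ linked k q r ⟧) (λ _ → k) ⟩
          ∑[ r < n ] (D q * ⟦ linked k q r ⟧) + (∑[ r < n ] k)
            ≡⟨ cong₂ _+_ (sym (*-distribˡ-sum (D q) (λ r → ⟦ linked k q r ⟧))) (sum-const n k) ⟩
          D q * row-links + n * k ∎

        shuffle : ∀ a w d m → a * (w * (d + m)) ≡ w * (a * d + a * m)
        shuffle = solve-∀
        collect : ∀ m w d j c → m * (w * (d * j + c + d * m)) ≡ (w * d) * (m * j + m * m) + (w * m) * c
        collect = solve-∀
        recollect : ∀ N a b c → N * (a + b) + N * c ≡ N * (a + c + b)
        recollect = solve-∀

    -- Summing `row` over `q` and comparing with `lower` leaves the factor `N` to cancel. After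
    -- division by `m`, the threshold `k` costs n²k/m and the shift costs nm; the choice of `m` will
    -- balance them.
    linked-pairs : m * sum degree ≤ m * (∑[ q < n ] ∑[ r < n ] ⟦ linked k q r ⟧) + n * (n * k) + n * (m * m)
    linked-pairs = *-cancelˡ-≤ N {{(n + m) !≢0}} (begin
      N * (m * sum degree)            ≡⟨ swap N m (sum degree) ⟩
      m * (sum degree * N)            ≤⟨ *-monoʳ-≤ m lower ⟩
      m * S                           ≡⟨ *-distribˡ-sum m (λ q → ∑[ y < n ] (⟦ A q y ⟧ * (W q * D y))) ⟩
      ∑[ q < n ] (m * (∑[ y < n ] (⟦ A q y ⟧ * (W q * D y))))
                                      ≤⟨ sum-mono-≤ row ⟩
      ∑[ q < n ] (N * (m * row-links q + n * k + m * m))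
                                      ≡⟨ *-distribˡ-sum N (λ q → m * row-links q + n * k + m * m) ⟨
      N * (∑[ q < n ] (m * row-links q + n * k + m * m))
                                      ≡⟨ cong (N *_) (∑-distrib-+ (λ q → m * row-links q + n * k) (λ _ → m * m)) ⟩
      N * (∑[ q < n ] (m * row-links q + n * k) + ∑[ q < n ] (m * m))
                                      ≡⟨ cong (N *_) (cong₂ _+_
                                           (trans (∑-distrib-+ (λ q → m * row-links q) (λ _ → n * k))
                                             (cong₂ _+_ (sym (*-distribˡ-sum m row-links)) (sum-const n (n * k))))
                                           (sum-const n (m * m))) ⟩
      N * (m * sum row-links + n * (n * k) + n * (m * m)) ∎)
      where
      open ≤-Reasoning
      row-links : Fin n → ℕ
      row-links q = ∑[ r < n ] ⟦ linked k q r ⟧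
      swap : ∀ a b c → a * (b * c) ≡ b * (c * a)
      swap = solve-∀

-- Triple sums and C₅⁻-free ternary relations

⟦⟧*⟦⟧≥1 : ∀ a b → 1 ≤ ⟦ a ⟧ * ⟦ b ⟧ → a ≡ true × b ≡ true
⟦⟧*⟦⟧≥1 true true _ = refl , refl

sum-support : ∀ {n} (f : Fin n → ℕ) → 1 ≤ sum f → ∃[ i ] 1 ≤ f i
sum-support {suc n} f 1≤ with f zero in eq
... | suc _ = zero , subst (1 ≤_) (sym eq) (s≤s z≤n)
... | zero  with i , p ← sum-support (f ∘ suc) 1≤ = suc i , p

-- As every value is at most 1, the index `j` accounts for at most one of the two units, and another
-- index must supply the rest.
sum-support₂ : ∀ {n} (f : Fin n → ℕ) → (∀ i → f i ≤ 1) → 2 ≤ sum f →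
               ∀ j → ∃[ i ] (j ≢ i × 1 ≤ f i)
sum-support₂ {suc n} f f≤1 2≤ zero
  with i , p ← sum-support (f ∘ suc) (+-cancelˡ-≤ 1 _ _ (≤-trans 2≤ (+-monoˡ-≤ _ (f≤1 zero)))) =
  suc i , (λ ()) , p
sum-support₂ {suc n} f f≤1 2≤ (suc j) with f zero in eq
... | suc _ = zero , (λ ()) , subst (1 ≤_) (sym eq) (s≤s z≤n)
... | zero  with i , j≢i , p ← sum-support₂ (f ∘ suc) (f≤1 ∘ suc) 2≤ j =
  suc i , (λ { refl → j≢i refl }) , p

sum≤1 : ∀ {n} (f : Fin n → ℕ) → (∀ i → f i ≤ 1) →
        (∀ i j → i ≢ j → 1 ≤ f i → 1 ≤ f j → ⊥) → sum f ≤ 1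
sum≤1 f f≤1 unique with sum f ≤? 1
... | yes p = p
... | no ≰1 with i , p ← sum-support f (≤-trans (s≤s z≤n) (≰⇒> ≰1))
            with j , i≢j , q ← sum-support₂ f f≤1 (≰⇒> ≰1) i = ⊥-elim (unique i j i≢j p q)

∑³ : ∀ {n} → (Fin n → Fin n → Fin n → ℕ) → ℕ
∑³ {n} f = ∑[ a < n ] ∑[ b < n ] ∑[ c < n ] f a b c

module _ {n : ℕ} where

  ∑³-mono : ∀ {f g : Fin n → Fin n → Fin n → ℕ} → (∀ a b c → f a b c ≤ g a b c) → ∑³ f ≤ ∑³ g
  ∑³-mono f≤g = sum-mono-≤ λ a → sum-mono-≤ λ b → sum-mono-≤ (f≤g a b)

  ∑³-cong : ∀ {f g : Fin n → Fin n → Fin n → ℕ} → (∀ a b c → f a b c ≡ g a b c) → ∑³ f ≡ ∑³ g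
  ∑³-cong f≡g = sum-cong-≗ λ a → sum-cong-≗ λ b → sum-cong-≗ (f≡g a b)

  ∑³-+ : ∀ (f g : Fin n → Fin n → Fin n → ℕ) → ∑³ (λ a b c → f a b c + g a b c) ≡ ∑³ f + ∑³ g
  ∑³-+ f g = trans (sum-cong-≗ λ a → trans (sum-cong-≗ λ b → ∑-distrib-+ (f a b) (g a b))
      (∑-distrib-+ (λ b → ∑[ c < n ] f a b c) (λ b → ∑[ c < n ] g a b c)))
    (∑-distrib-+ (λ a → ∑[ b < n ] ∑[ c < n ] f a b c) (λ a → ∑[ b < n ] ∑[ c < n ] g a b c))

  ∑³-*ˡ : ∀ k (f : Fin n → Fin n → Fin n → ℕ) → k * ∑³ f ≡ ∑³ (λ a b c → k * f a b c)
  ∑³-*ˡ k f = trans (*-distribˡ-sum k (λ a → ∑[ b < n ] ∑[ c < n ] f a b c)) (sum-cong-≗ λ a →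
    trans (*-distribˡ-sum k (λ b → ∑[ c < n ] f a b c)) (sum-cong-≗ λ b → *-distribˡ-sum k (f a b)))

  ∑³-≤1 : ∀ {f : Fin n → Fin n → Fin n → ℕ} → (∀ a b c → f a b c ≤ 1) → ∑³ f ≤ n * (n * n)
  ∑³-≤1 f≤1 = ≤-trans (sum-bounded λ a → sum-bounded λ b → sum-bounded (f≤1 a b))
    (≤-reflexive (cong (λ z → n * (n * z)) (*-identityʳ n)))

  ∑³-swap : ∀ (f : Fin n → Fin n → Fin n → ℕ) → ∑³ (λ a b c → f b a c) ≡ ∑³ f
  ∑³-swap f = ∑-comm (λ a b → ∑[ c < n ] f b a c)

  ∑³-rotate : ∀ (f : Fin n → Fin n → Fin n → ℕ) → ∑³ (λ a b c → f c a b) ≡ ∑³ f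
  ∑³-rotate f = trans (sum-cong-≗ λ a → ∑-comm (λ b c → f c a b)) (∑-comm (λ a c → ∑[ b < n ] f c a b))

-- In free, every pair of vertices except {b, e} lies in one of the edges, so b ≢ e is enough to make
-- all five vertices distinct when R holds only of distinct vertices.
record IsC₅⁻-free {n} (R : Fin n → Fin n → Fin n → Bool) : Set where
  field
    swap₁₂ : ∀ a b c → R a b c ≡ R b a c
    swap₂₃ : ∀ a b c → R a b c ≡ R a c b
    free   : ∀ {a b c d e} → b ≢ e →
             R a b c ≡ true → R b c d ≡ true → R c d e ≡ true → R d e a ≡ true → ⊥

-- Upper bound for C₅⁻-free relations

module _ {n} {R : Fin n → Fin n → Fin n → Bool} (G : IsC₅⁻-free R) where
  open IsC₅⁻-free G

  private
    rotate : ∀ a b c → R a b c ≡ R b c a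
    rotate a b c = trans (swap₁₂ a b c) (swap₂₃ b a c)

    via : ∀ {b b′ : Bool} → b ≡ b′ → b ≡ true → b′ ≡ true
    via p q = trans (sym p) q

  -- The vertices q, u, r, t, v in this order form a C₅⁻. Hence a triangle q r t lies in the link of
  -- at most one vertex.
  unique-apex : ∀ {u v q r t} → u ≢ v → R u q r ≡ true → R u r t ≡ true →
                R v q t ≡ true → R v r t ≡ true → ⊥
  unique-apex {u} {v} {q} {r} {t} u≢v uqr urt vqt vrt = free u≢v
    (via (swap₁₂ u q r) uqr) urt (via (rotate v r t) vrt)
    (via (trans (swap₂₃ v q t) (swap₁₂ v t q)) vqt)

  module _ (k : ℕ) where

    common : Fin n → Fin n → Fin n → Bool
    common u = linked (R u) k

    private
      codegree-≥ : ∀ {u q r} → common u q r ≡ true → k ≤ codegree (R u) q r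
      codegree-≥ {u} {q} {r} eq = ≤ᵇ⇒≤ k _ (Equivalence.from Bool.T-≡ eq)

      common-sym : ∀ u q r → common u q r ≡ common u r q
      common-sym u q r = cong (k ≤ᵇ_) (sum-cong-≗ λ t →
        trans (cong₂ (λ a b → ⟦ a ⟧ * ⟦ b ⟧) (swap₂₃ u q t) (swap₂₃ u t r)) (*-comm ⟦ R u t q ⟧ _))

      term≤1 : ∀ u q r t → ⟦ R u q t ⟧ * ⟦ R u t r ⟧ ≤ 1
      term≤1 u q r t = *-mono-≤ (⟦⟧≤1 (R u q t)) (⟦⟧≤1 (R u t r))

    -- The two common neighbours t ≠ t′ make r, t, u, q, t′ a copy of C₅⁻.
    common-exclusive : 2 ≤ k → ∀ {u q r} → common u q r ≡ true → common q u r ≡ true → ⊥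
    common-exclusive 2≤k {u} {q} {r} at-u at-q
      with t , p ← sum-support _ (≤-trans (≤-trans (s≤s z≤n) 2≤k) (codegree-≥ at-u))
      with t′ , t≢t′ , p′ ← sum-support₂ _ (term≤1 q u r) (≤-trans 2≤k (codegree-≥ at-q)) t
      with uqt , utr ← ⟦⟧*⟦⟧≥1 _ _ p | qut′ , qt′r ← ⟦⟧*⟦⟧≥1 _ _ p′ =
      free t≢t′ (via (trans (rotate u t r) (swap₁₂ t r u)) utr)
                (via (trans (rotate u q t) (rotate q t u)) uqt)
                (via (swap₁₂ q u t′) qut′) qt′r

    -- Off the edges, `common-exclusive` lets at most one of the three vertices link the other two.
    -- On an edge, each `common` indicator reappears on the right as its product with `R`, and the 1
    -- matches `R u q r`.
    exclusive-sum : 2 ≤ k → ∀ u q r →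
      ⟦ common u q r ⟧ + ⟦ common q u r ⟧ + ⟦ common r u q ⟧ + ⟦ R u q r ⟧ ≤
      1 + (⟦ common u q r ⟧ * ⟦ R u q r ⟧ + ⟦ common q u r ⟧ * ⟦ R q u r ⟧ + ⟦ common r u q ⟧ * ⟦ R r u q ⟧)
    exclusive-sum 2≤k u q r
      rewrite swap₁₂ q u r | rotate r u q = bits (R u q r)
        (common-exclusive 2≤k)
        (λ p p′ → common-exclusive 2≤k (via (common-sym u q r) p) p′)
        (λ p p′ → common-exclusive 2≤k (via (common-sym q u r) p) (via (common-sym r u q) p′))
      where
      bits : ∀ c {x y z} → (x ≡ true → y ≡ true → ⊥) → (x ≡ true → z ≡ true → ⊥) →
             (y ≡ true → z ≡ true → ⊥) → ⟦ x ⟧ + ⟦ y ⟧ + ⟦ z ⟧ + ⟦ c ⟧ ≤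
             1 + (⟦ x ⟧ * ⟦ c ⟧ + ⟦ y ⟧ * ⟦ c ⟧ + ⟦ z ⟧ * ⟦ c ⟧)
      bits true {x} {y} {z} _ _ _ = ≤-reflexive (trans (+-comm _ 1) (cong (1 +_)
        (sym (cong₂ _+_ (cong₂ _+_ (*-identityʳ ⟦ x ⟧) (*-identityʳ ⟦ y ⟧)) (*-identityʳ ⟦ z ⟧)))))
      bits false {true}  {true}  {_}     xy _ _ = ⊥-elim (xy refl refl)
      bits false {true}  {_}     {true}  _ xz _ = ⊥-elim (xz refl refl)
      bits false {_}     {true}  {true}  _ _ yz = ⊥-elim (yz refl refl)
      bits false {true}  {false} {false} _ _ _  = s≤s z≤n
      bits false {false} {true}  {false} _ _ _  = s≤s z≤n
      bits false {false} {false} {true}  _ _ _  = s≤s z≤n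
      bits false {false} {false} {false} _ _ _  = z≤n

    -- By `unique-apex` the inner sum is at most 1 for each ordered triple q, r, t.
    apex-count : ∑³ (λ q r t → ∑[ u < n ] (⟦ R u q r ⟧ * (⟦ R u q t ⟧ * ⟦ R u t r ⟧))) ≤ n * (n * n)
    apex-count = ∑³-≤1 λ q r t → sum≤1 _
      (λ u → *-mono-≤ (⟦⟧≤1 (R u q r)) (term≤1 u q r t))
      λ u v u≢v p p′ → case u≢v (factors _ _ p) (factors _ _ p′)
      where
      factors : ∀ a b {c} → 1 ≤ ⟦ a ⟧ * (⟦ b ⟧ * ⟦ c ⟧) → a ≡ true × b ≡ true × c ≡ true
      factors true true {true} _ = refl , refl , refl
      case : ∀ {u v q r t} → u ≢ v → R u q r ≡ true × R u q t ≡ true × R u t r ≡ true →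
             R v q r ≡ true × R v q t ≡ true × R v t r ≡ true → ⊥
      case {u} {v} {q} {r} {t} u≢v (uqr , uqt , utr) (vqr , vqt , vtr) =
        unique-apex u≢v uqr (via (swap₂₃ u t r) utr) vqt (via (swap₂₃ v t r) vtr)

    -- If u q r is an edge and q, r are linked at u, at least k vertices t complete a triangle q r t
    -- in the link of u. These are the K₄⁻'s with apex u that `apex-count` bounds.
    common-edges : k * ∑³ (λ u q r → ⟦ common u q r ⟧ * ⟦ R u q r ⟧) ≤ n * (n * n)
    common-edges = begin
      k * ∑³ (λ u q r → ⟦ common u q r ⟧ * ⟦ R u q r ⟧)
        ≡⟨ ∑³-*ˡ k (λ u q r → ⟦ common u q r ⟧ * ⟦ R u q r ⟧) ⟩
      ∑³ (λ u q r → k * (⟦ common u q r ⟧ * ⟦ R u q r ⟧))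
        ≤⟨ ∑³-mono (λ u q r → bound u q r) ⟩
      ∑³ (λ u q r → ⟦ R u q r ⟧ * codegree (R u) q r)
        ≡⟨ ∑³-cong (λ u q r → *-distribˡ-sum ⟦ R u q r ⟧ (λ t → ⟦ R u q t ⟧ * ⟦ R u t r ⟧)) ⟩
      ∑³ (λ u q r → ∑[ t < n ] f u q r t)
        -- Three interchanges carry the sum over `u` to the innermost place.
        ≡⟨ ∑-comm (λ u q → ∑[ r < n ] ∑[ t < n ] f u q r t) ⟩
      ∑³ (λ q u r → ∑[ t < n ] f u q r t)
        ≡⟨ sum-cong-≗ (λ q → ∑-comm (λ u r → ∑[ t < n ] f u q r t)) ⟩
      ∑³ (λ q r u → ∑[ t < n ] f u q r t)
        ≡⟨ sum-cong-≗ (λ q → sum-cong-≗ λ r → ∑-comm (λ u t → f u q r t)) ⟩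
      ∑³ (λ q r t → ∑[ u < n ] f u q r t)
        ≤⟨ apex-count ⟩
      n * (n * n) ∎
      where
      open ≤-Reasoning
      f : Fin n → Fin n → Fin n → Fin n → ℕ
      f u q r t = ⟦ R u q r ⟧ * (⟦ R u q t ⟧ * ⟦ R u t r ⟧)
      bound : ∀ u q r → k * (⟦ common u q r ⟧ * ⟦ R u q r ⟧) ≤ ⟦ R u q r ⟧ * codegree (R u) q r
      bound u q r with common u q r in eq
      ... | false = ≤-trans (≤-reflexive (*-zeroʳ k)) z≤n
      ... | true  = ≤-trans (≤-reflexive (trans (cong (k *_) (*-identityˡ _)) (*-comm k _)))
                      (*-monoʳ-≤ ⟦ R u q r ⟧ (codegree-≥ eq))

    -- Summed over all ordered triples, the three terms of `exclusive-sum` have equal totals, by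
    -- swapping and rotating the variables.
    ∑-common : 2 ≤ k → 3 * ∑³ (λ u q r → ⟦ common u q r ⟧) + ∑³ (λ u q r → ⟦ R u q r ⟧) ≤
               n * (n * n) + 3 * ∑³ (λ u q r → ⟦ common u q r ⟧ * ⟦ R u q r ⟧)
    ∑-common 2≤k = begin
      3 * ∑³ I + ∑³ E
        ≡⟨ cong (_+ ∑³ E) (thrice I) ⟨
      ∑³ (λ u q r → I u q r + I q u r + I r u q) + ∑³ E
        ≡⟨ ∑³-+ (λ u q r → I u q r + I q u r + I r u q) E ⟨
      ∑³ (λ u q r → I u q r + I q u r + I r u q + E u q r)
        ≤⟨ ∑³-mono (exclusive-sum 2≤k) ⟩
      ∑³ (λ u q r → 1 + (B u q r + B q u r + B r u q))
        ≡⟨ ∑³-+ (λ _ _ _ → 1) (λ u q r → B u q r + B q u r + B r u q) ⟩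
      ∑³ {n} (λ _ _ _ → 1) + ∑³ (λ u q r → B u q r + B q u r + B r u q)
        ≤⟨ +-mono-≤ (∑³-≤1 {n} λ _ _ _ → ≤-refl) (≤-reflexive (thrice B)) ⟩
      n * (n * n) + 3 * ∑³ B ∎
      where
      open ≤-Reasoning
      I E B : Fin n → Fin n → Fin n → ℕ
      I u q r = ⟦ common u q r ⟧
      E u q r = ⟦ R u q r ⟧
      B u q r = I u q r * E u q r
      triple-sum : ∀ x → x + x + x ≡ 3 * x
      triple-sum = solve-∀
      thrice : ∀ (f : Fin n → Fin n → Fin n → ℕ) → ∑³ (λ u q r → f u q r + f q u r + f r u q) ≡ 3 * ∑³ f
      thrice f = trans (∑³-+ (λ u q r → f u q r + f q u r) (λ u q r → f r u q)) (trans
        (cong₂ _+_ (trans (∑³-+ f (λ u q r → f q u r)) (cong (∑³ f +_) (∑³-swap f))) (∑³-rotate f))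
        (triple-sum (∑³ f)))

    -- This is `linked-pairs` for the link graph `R u`, added up over all `u`.
    ∑-links : ∀ m .{{_ : NonZero m}} → m * ∑³ (λ u q r → ⟦ R u q r ⟧) ≤
              m * ∑³ (λ u q r → ⟦ common u q r ⟧) + n * (n * (n * k)) + n * (n * (m * m))
    ∑-links m = begin
      m * ∑³ (λ u q r → ⟦ R u q r ⟧)
        ≡⟨ *-distribˡ-sum m (λ u → sum (degree (R u))) ⟩
      ∑[ u < n ] (m * sum (degree (R u)))
        ≤⟨ sum-mono-≤ (λ u → linked-pairs (R u) (swap₂₃ u) k m) ⟩
      ∑[ u < n ] (m * g u + n * (n * k) + n * (m * m))
        ≡⟨ trans (∑-distrib-+ (λ u → m * g u + n * (n * k)) (λ _ → n * (m * m)))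
             (cong₂ _+_ (trans (∑-distrib-+ (λ u → m * g u) (λ _ → n * (n * k)))
               (cong₂ _+_ (sym (*-distribˡ-sum m g)) (sum-const n (n * (n * k))))) (sum-const n (n * (m * m)))) ⟩
      m * ∑³ (λ u q r → ⟦ common u q r ⟧) + n * (n * (n * k)) + n * (n * (m * m)) ∎
      where
      open ≤-Reasoning
      g : Fin n → ℕ
      g u = ∑[ q < n ] ∑[ r < n ] ⟦ common u q r ⟧

  -- With X, I, B as below, X ≤ I + 2n³/k, 3I + X ≤ n³ + 3B and B ≤ n³/k together give 4X ≤ n³ +
  -- 9n³/k.
  edge-density : ∀ k → 2 ≤ k → k * k * k ≤ n →
                 k * (4 * ∑³ (λ u q r → ⟦ R u q r ⟧)) ≤ (k + 9) * (n * (n * n))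
  edge-density k@(suc _) 2≤k k³≤n = *-cancelˡ-≤ (k * k) (begin
    k * k * (k * (4 * X))
      ≡⟨ split k X ⟩
    3 * k * (k * k * X) + k * (k * k) * X
      -- The choice m = k² turns the errors n³k/m and n²m into n³/k and n²k², and the latter is at
      -- most n³/k because k³ ≤ n.
      ≤⟨ +-monoˡ-≤ _ (*-monoʳ-≤ (3 * k) (∑-links k (k * k))) ⟩
    3 * k * (k * k * I + n * (n * (n * k)) + n * (n * (k * k * (k * k)))) + k * (k * k) * X
      ≡⟨ regroup k I n X ⟩
    k * (k * k) * (3 * I + X) + (3 * (k * k)) * (n * (n * n) + n * n * (k * k * k))
      ≤⟨ +-mono-≤ (*-monoʳ-≤ (k * (k * k)) (∑-common k 2≤k)) (*-monoʳ-≤ (3 * (k * k))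
           (+-monoʳ-≤ (n * (n * n)) (*-monoʳ-≤ (n * n) k³≤n))) ⟩
    k * (k * k) * (n * (n * n) + 3 * B) + (3 * (k * k)) * (n * (n * n) + n * n * n)
      ≡⟨ isolate k n B ⟩
    k * k * (3 * (k * B) + (k + 6) * (n * (n * n)))
      ≤⟨ *-monoʳ-≤ (k * k) (+-monoˡ-≤ _ (*-monoʳ-≤ 3 (common-edges k))) ⟩
    k * k * (3 * (n * (n * n)) + (k + 6) * (n * (n * n)))
      ≡⟨ cong (k * k *_) (collect k (n * (n * n))) ⟩
    k * k * ((k + 9) * (n * (n * n))) ∎)
    where
    open ≤-Reasoning
    X I B : ℕ
    X = ∑³ λ u q r → ⟦ R u q r ⟧
    I = ∑³ λ u q r → ⟦ common k u q r ⟧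
    B = ∑³ λ u q r → ⟦ common k u q r ⟧ * ⟦ R u q r ⟧
    split : ∀ k x → k * k * (k * (4 * x)) ≡ 3 * k * (k * k * x) + k * (k * k) * x
    split = solve-∀
    regroup : ∀ k i n x →
      3 * k * (k * k * i + n * (n * (n * k)) + n * (n * (k * k * (k * k)))) + k * (k * k) * x ≡
      k * (k * k) * (3 * i + x) + (3 * (k * k)) * (n * (n * n) + n * n * (k * k * k))
    regroup = solve-∀
    isolate : ∀ k n b → k * (k * k) * (n * (n * n) + 3 * b) + (3 * (k * k)) * (n * (n * n) + n * n * n) ≡
      k * k * (3 * (k * b) + (k + 6) * (n * (n * n)))
    isolate = solve-∀
    collect : ∀ k c → 3 * c + (k + 6) * c ≡ (k + 9) * c
    collect = solve-∀

-- The iterated blow-up of an edge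

-- The Boolean is the verdict of the remaining digits, consulted only when the three digits
-- coincide.
split₃ : Fin 3 → Fin 3 → Fin 3 → Bool → Bool
split₃ i j k b = (not (i =? j) ∧ not (j =? k) ∧ not (i =? k)) ∨ ((i =? j) ∧ (j =? k) ∧ b)
  where
  _=?_ : Fin 3 → Fin 3 → Bool
  i =? j = does (i Fin.≟ j)

-- a, b, c span an edge iff, at the lowest base-3 digit at which they are not all equal, they are
-- pairwise distinct.  Only the h lowest digits are inspected.
nested : ℕ → ℕ → ℕ → ℕ → Bool
nested zero    a b c = false
nested (suc h) a b c = split₃ (a mod 3) (b mod 3) (c mod 3) (nested h (a ℕ./ 3) (b ℕ./ 3) (c ℕ./ 3))

-- Settled by enumerating the digits, one value of the Boolean at a time because `Fin.all?` ranges
-- over `Fin` only.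
split₃-swap₁₂ : ∀ i j k b → split₃ i j k b ≡ split₃ j i k b
split₃-swap₁₂ i j k true = from-yes (Fin.all? λ i → Fin.all? λ j → Fin.all? λ k →
  split₃ i j k true Bool.≟ split₃ j i k true) i j k
split₃-swap₁₂ i j k false = from-yes (Fin.all? λ i → Fin.all? λ j → Fin.all? λ k →
  split₃ i j k false Bool.≟ split₃ j i k false) i j k

split₃-swap₂₃ : ∀ i j k b → split₃ i j k b ≡ split₃ i k j b
split₃-swap₂₃ i j k true = from-yes (Fin.all? λ i → Fin.all? λ j → Fin.all? λ k →
  split₃ i j k true Bool.≟ split₃ i k j true) i j k
split₃-swap₂₃ i j k false = from-yes (Fin.all? λ i → Fin.all? λ j → Fin.all? λ k →
  split₃ i j k false Bool.≟ split₃ i k j false) i j k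

split₃-true : ∀ i j k {b} → split₃ i j k b ≡ true →
              (i ≢ j × j ≢ k × i ≢ k) ⊎ (i ≡ j × j ≡ k × b ≡ true)
split₃-true i j k eq with i Fin.≟ j | j Fin.≟ k | i Fin.≟ k
... | no i≢j  | no j≢k  | no i≢k = inj₁ (i≢j , j≢k , i≢k)
... | yes i≡j | yes j≡k | _      = inj₂ (i≡j , j≡k , eq)

pigeonhole₃ : ∀ (i j k l : Fin 3) → i ≢ j → j ≢ k → i ≢ k → j ≢ l → k ≢ l → l ≢ i → ⊥
pigeonhole₃ = from-yes (Fin.all? {3} λ i → Fin.all? {3} λ j → Fin.all? {3} λ k → Fin.all? {3} λ l →
  ¬? (i Fin.≟ j) →-dec ¬? (j Fin.≟ k) →-dec ¬? (i Fin.≟ k) →-dec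
  ¬? (j Fin.≟ l) →-dec ¬? (k Fin.≟ l) →-dec ¬? (¬? (l Fin.≟ i)))

-- Consecutive edges share two vertices, whose digits agree or differ, so all four edges are of the
-- same kind. Were they all split by this digit, i, j, k, l would be four distinct elements of
-- `Fin 3`. So the digits agree and the remaining digits decide all four.
split₃-free : ∀ i j k l m {x y z w} → split₃ i j k x ≡ true → split₃ j k l y ≡ true →
              split₃ k l m z ≡ true → split₃ l m i w ≡ true →
              x ≡ true × y ≡ true × z ≡ true × w ≡ true
split₃-free i j k l m p q r s
  with split₃-true i j k p | split₃-true j k l q | split₃-true k l m r | split₃-true l m i s
... | inj₂ (_ , _ , x) | inj₂ (_ , _ , y) | inj₂ (_ , _ , z) | inj₂ (_ , _ , w) = x , y , z , w
-- The fourth edge supplies `l≢i`, the one pair that the first two edges do not separate.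
... | inj₁ (i≢j , j≢k , i≢k) | inj₁ (_ , k≢l , j≢l) | inj₁ _ | inj₁ (_ , _ , l≢i) =
  ⊥-elim (pigeonhole₃ i j k l i≢j j≢k i≢k j≢l k≢l l≢i)
... | inj₂ (_ , j≡k , _) | inj₁ (j≢k , _) | _ | _ = contradiction j≡k j≢k
... | inj₁ (_ , j≢k , _) | inj₂ (j≡k , _) | _ | _ = contradiction j≡k j≢k
... | _ | inj₂ (_ , k≡l , _) | inj₁ (k≢l , _) | _ = contradiction k≡l k≢l
... | _ | inj₁ (_ , k≢l , _) | inj₂ (k≡l , _) | _ = contradiction k≡l k≢l
... | _ | _ | inj₂ (_ , l≡m , _) | inj₁ (l≢m , _) = contradiction l≡m l≢m
... | _ | _ | inj₁ (_ , l≢m , _) | inj₂ (l≡m , _) = contradiction l≡m l≢m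

nested-swap₁₂ : ∀ h a b c → nested h a b c ≡ nested h b a c
nested-swap₁₂ zero    a b c = refl
nested-swap₁₂ (suc h) a b c = trans (split₃-swap₁₂ (a mod 3) (b mod 3) (c mod 3) _)
  (cong (split₃ (b mod 3) (a mod 3) (c mod 3)) (nested-swap₁₂ h (a ℕ./ 3) (b ℕ./ 3) (c ℕ./ 3)))

nested-swap₂₃ : ∀ h a b c → nested h a b c ≡ nested h a c b
nested-swap₂₃ zero    a b c = refl
nested-swap₂₃ (suc h) a b c = trans (split₃-swap₂₃ (a mod 3) (b mod 3) (c mod 3) _)
  (cong (split₃ (a mod 3) (c mod 3) (b mod 3)) (nested-swap₂₃ h (a ℕ./ 3) (b ℕ./ 3) (c ℕ./ 3)))

nested-free : ∀ h {a b c d e} → nested h a b c ≡ true → nested h b c d ≡ true →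
              nested h c d e ≡ true → nested h d e a ≡ true → ⊥
nested-free (suc h) {a} {b} {c} {d} {e} p q r s
  with p , q , r , s ← split₃-free (a mod 3) (b mod 3) (c mod 3) (d mod 3) (e mod 3) p q r s =
  nested-free h {a ℕ./ 3} {b ℕ./ 3} {c ℕ./ 3} {d ℕ./ 3} {e ℕ./ 3} p q r s

nested-irreflexive : ∀ h {a c} → nested h a a c ≡ true → ⊥
nested-irreflexive (suc h) {a} {c} p with split₃-true (a mod 3) (a mod 3) (c mod 3) p
... | inj₁ (a≢a , _)   = a≢a refl
... | inj₂ (_ , _ , q) = nested-irreflexive h {a ℕ./ 3} {c ℕ./ 3} q

-- Counting the edges of the blow-up

count : ℕ → ℕ → ℕ
count h n = ∑³ {n} λ a b c → ⟦ nested h (toℕ a) (toℕ b) (toℕ c) ⟧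

∑-prefix : ∀ {m n} (f : ℕ → ℕ) → m ≤ n → ∑[ a < m ] f (toℕ a) ≤ ∑[ a < n ] f (toℕ a)
∑-prefix f z≤n       = z≤n
∑-prefix f (s≤s m≤n) = +-monoʳ-≤ (f 0) (∑-prefix (f ∘ suc) m≤n)

∑-+ : ∀ p q (f : ℕ → ℕ) →
      ∑[ a < p + q ] f (toℕ a) ≡ ∑[ r < p ] f (toℕ r) + ∑[ b < q ] f (p + toℕ b)
∑-+ zero    q f = refl
∑-+ (suc p) q f = trans (cong (f 0 +_) (∑-+ p q (f ∘ suc))) (sym (+-assoc (f 0) _ _))

-- The index is written as `r + i * p`; for p = 3, `r` is its lowest digit and `i` the number formed
-- by the others.
∑-blocks : ∀ p m (f : ℕ → ℕ) →
           ∑[ a < m * p ] f (toℕ a) ≡ ∑[ i < m ] ∑[ r < p ] f (toℕ r + toℕ i * p)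
∑-blocks p zero    f = refl
∑-blocks p (suc m) f = begin
  ∑[ a < p + m * p ] f (toℕ a)
    ≡⟨ ∑-+ p (m * p) f ⟩
  ∑[ r < p ] f (toℕ r) + ∑[ b < m * p ] f (p + toℕ b)
    ≡⟨ cong₂ _+_ (sum-cong-≗ {p} λ r → cong f (sym (+-identityʳ (toℕ r)))) (∑-blocks p m (f ∘ (p +_))) ⟩
  ∑[ r < p ] f (toℕ r + 0) + ∑[ i < m ] ∑[ r < p ] f (p + (toℕ r + toℕ i * p))
    ≡⟨ cong (∑[ r < p ] f (toℕ r + 0) +_) (sum-cong-≗ {m} λ i → sum-cong-≗ {p} λ r →
         cong f (exchange p (toℕ r) (toℕ i * p))) ⟩
  ∑[ r < p ] f (toℕ r + 0) + ∑[ i < m ] ∑[ r < p ] f (toℕ r + (p + toℕ i * p)) ∎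
  where
  open ≡-Reasoning
  exchange : ∀ p a b → p + (a + b) ≡ a + (p + b)
  exchange = solve-∀

∑³-blocks : ∀ p m (g : ℕ → ℕ → ℕ → ℕ) →
  ∑³ {m * p} (λ a b c → g (toℕ a) (toℕ b) (toℕ c)) ≡
  ∑³ {m} (λ i j k → ∑³ {p} (λ r s t → g (toℕ r + toℕ i * p) (toℕ s + toℕ j * p) (toℕ t + toℕ k * p)))
∑³-blocks p m g = begin
  ∑³ {m * p} (λ a b c → g (toℕ a) (toℕ b) (toℕ c))
    ≡⟨ ∑-blocks p m (λ a → ∑[ b < m * p ] ∑[ c < m * p ] g a (toℕ b) (toℕ c)) ⟩
  (∑[ i < m ] ∑[ r < p ] ∑[ b < m * p ] ∑[ c < m * p ] g (x r i) (toℕ b) (toℕ c))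
    ≡⟨ (sum-cong-≗ {m} λ i → sum-cong-≗ {p} λ r → trans
         (∑-blocks p m λ b → ∑[ c < m * p ] g (x r i) b (toℕ c))
         (sum-cong-≗ {m} λ j → sum-cong-≗ {p} λ s → ∑-blocks p m λ c → g (x r i) (x s j) c)) ⟩
  (∑[ i < m ] ∑[ r < p ] ∑[ j < m ] ∑[ s < p ] ∑[ k < m ] ∑[ t < p ] f i j k r s t)
    ≡⟨ (sum-cong-≗ {m} λ i → ∑-comm λ r j → ∑[ s < p ] ∑[ k < m ] ∑[ t < p ] f i j k r s t) ⟩
  (∑[ i < m ] ∑[ j < m ] ∑[ r < p ] ∑[ s < p ] ∑[ k < m ] ∑[ t < p ] f i j k r s t)
    ≡⟨ (sum-cong-≗ {m} λ i → sum-cong-≗ {m} λ j → trans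
         (sum-cong-≗ {p} λ r → ∑-comm λ s k → ∑[ t < p ] f i j k r s t)
         (∑-comm λ r k → ∑[ s < p ] ∑[ t < p ] f i j k r s t)) ⟩
  ∑³ (λ i j k → ∑³ (f i j k)) ∎
  where
  open ≡-Reasoning
  x : Fin p → Fin m → ℕ
  x r i = toℕ r + toℕ i * p
  f : (i j k : Fin m) (r s t : Fin p) → ℕ
  f i j k r s t = g (x r i) (x s j) (x t k)

digit-mod : ∀ (r : Fin 3) i → (toℕ r + i * 3) mod 3 ≡ r
digit-mod r i = Fin.toℕ-injective (begin
  toℕ ((toℕ r + i * 3) mod 3) ≡⟨ Fin.toℕ-fromℕ< _ ⟩
  (toℕ r + i * 3) % 3         ≡⟨ [m+kn]%n≡m%n (toℕ r) i 3 ⟩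
  toℕ r % 3                   ≡⟨ m<n⇒m%n≡m (Fin.toℕ<n r) ⟩
  toℕ r                       ∎)
  where open ≡-Reasoning

digit-/ : ∀ (r : Fin 3) i → (toℕ r + i * 3) ℕ./ 3 ≡ i
digit-/ r i = begin
  (toℕ r + i * 3) ℕ./ 3      ≡⟨ +-distrib-/ (toℕ r) (i * 3) small ⟩
  toℕ r ℕ./ 3 + i * 3 ℕ./ 3  ≡⟨ cong₂ _+_ (m<n⇒m/n≡0 (Fin.toℕ<n r)) (m*n/n≡m i 3) ⟩
  i                          ∎
  where
  open ≡-Reasoning
  small : toℕ r % 3 + i * 3 % 3 < 3
  small = subst (_< 3) (sym (trans (cong₂ _+_ (m<n⇒m%n≡m (Fin.toℕ<n r)) (m*n%n≡0 i 3)) (+-identityʳ _))) (Fin.toℕ<n r)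

nested-digits : ∀ h (r s t : Fin 3) i j k →
  nested (suc h) (toℕ r + i * 3) (toℕ s + j * 3) (toℕ t + k * 3) ≡ split₃ r s t (nested h i j k)
nested-digits h r s t i j k
  rewrite digit-mod r i | digit-mod s j | digit-mod t k | digit-/ r i | digit-/ s j | digit-/ t k = refl

-- The six orderings of three distinct digits are edges outright, and the three constant triples
-- inherit `b`.
split₃-count : ∀ b → ∑³ (λ r s t → ⟦ split₃ r s t b ⟧) ≡ 6 + 3 * ⟦ b ⟧
split₃-count true  = refl
split₃-count false = refl

-- The lowest digit cuts the 3m vertices into three classes of size m. There are 6m³ ordered triples
-- that meet all three classes, and each class carries a copy of the level below.
count-blocks : ∀ h m → count (suc h) (m * 3) ≡ m * (m * (m * 6)) + 3 * count h m
count-blocks h m = begin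
  count (suc h) (m * 3)
    ≡⟨ ∑³-blocks 3 m (λ a b c → ⟦ nested (suc h) a b c ⟧) ⟩
  ∑³ {m} (λ i j k → ∑³ {3} (λ r s t →
    ⟦ nested (suc h) (toℕ r + toℕ i * 3) (toℕ s + toℕ j * 3) (toℕ t + toℕ k * 3) ⟧))
    ≡⟨ ∑³-cong {m} (λ i j k → trans (∑³-cong {3}
         {f = λ r s t → ⟦ nested (suc h) (toℕ r + toℕ i * 3) (toℕ s + toℕ j * 3) (toℕ t + toℕ k * 3) ⟧}
         {g = λ r s t → ⟦ split₃ r s t (nested h (toℕ i) (toℕ j) (toℕ k)) ⟧}
         (λ r s t → cong ⟦_⟧ (nested-digits h r s t (toℕ i) (toℕ j) (toℕ k))))
         (split₃-count (nested h (toℕ i) (toℕ j) (toℕ k)))) ⟩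
  ∑³ {m} (λ i j k → 6 + 3 * g i j k)
    ≡⟨ ∑³-+ {m} (λ _ _ _ → 6) (λ i j k → 3 * g i j k) ⟩
  ∑³ {m} (λ _ _ _ → 6) + ∑³ {m} (λ i j k → 3 * g i j k)
    ≡⟨ cong₂ _+_ six (sym (∑³-*ˡ {m} 3 g)) ⟩
  m * (m * (m * 6)) + 3 * count h m ∎
  where
  open ≡-Reasoning
  g : Fin m → Fin m → Fin m → ℕ
  g i j k = ⟦ nested h (toℕ i) (toℕ j) (toℕ k) ⟧
  six : ∑³ {m} (λ _ _ _ → 6) ≡ m * (m * (m * 6))
  six = trans (sum-cong-≗ {m} λ _ → trans (sum-cong-≗ {m} λ _ → sum-const m 6) (sum-const m (m * 6)))
          (sum-const m (m * (m * 6)))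

count-mono : ∀ h {m n} → m ≤ n → count h m ≤ count h n
count-mono h {m} {n} m≤n = ≤-trans
  (∑-prefix (λ a → ∑[ b < m ] ∑[ c < m ] g a (toℕ b) (toℕ c)) m≤n)
  (sum-mono-≤ {n} λ a → ≤-trans (∑-prefix (λ b → ∑[ c < m ] g (toℕ a) b (toℕ c)) m≤n)
    (sum-mono-≤ {n} λ b → ∑-prefix (λ c → g (toℕ a) (toℕ b) c) m≤n))
  where
  g : ℕ → ℕ → ℕ → ℕ
  g a b c = ⟦ nested h a b c ⟧

-- With c for 17 and 3c for 51, the worst remainder 2 asks for 54 + 3c ≤ 9c among the coefficients
-- of m², which c = 17 meets with room to spare.
cube-bound : ∀ m {r} → r < 3 → let n = r + m * 3 in
             n * (n * n) + 51 * (m * m) ≤ 27 * (m * (m * m)) + 17 * (n * n)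
cube-bound m {0} _ = ≤-trans (m≤m+n _ (102 * (m * m))) (≤-reflexive (slack m))
  where
  slack : ∀ m → (m * 3) * ((m * 3) * (m * 3)) + 51 * (m * m) + 102 * (m * m) ≡
          27 * (m * (m * m)) + 17 * ((m * 3) * (m * 3))
  slack = solve-∀
cube-bound m {1} _ = ≤-trans (m≤m+n _ (75 * (m * m) + 93 * m + 16)) (≤-reflexive (slack m))
  where
  slack : ∀ m → (1 + m * 3) * ((1 + m * 3) * (1 + m * 3)) + 51 * (m * m) + (75 * (m * m) + 93 * m + 16) ≡
          27 * (m * (m * m)) + 17 * ((1 + m * 3) * (1 + m * 3))
  slack = solve-∀
cube-bound m {2} _ = ≤-trans (m≤m+n _ (48 * (m * m) + 168 * m + 60)) (≤-reflexive (slack m))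
  where
  slack : ∀ m → (2 + m * 3) * ((2 + m * 3) * (2 + m * 3)) + 51 * (m * m) + (48 * (m * m) + 168 * m + 60) ≡
          27 * (m * (m * m)) + 17 * ((2 + m * 3) * (2 + m * 3))
  slack = solve-∀
cube-bound m {suc (suc (suc r))} (s≤s (s≤s (s≤s ())))

-- 17 n² absorbs the rounding of n down to a multiple of 3 at every level.
count-lower : ∀ h n → n ≤ h → n * (n * n) ≤ 4 * count h n + 17 * (n * n)
count-lower h       zero      _         = z≤n
count-lower (suc h) n@(suc _) (s≤s n≤h) = +-cancelʳ-≤ (51 * (m * m)) _ _ (begin
  n * (n * n) + 51 * (m * m)
    ≤⟨ subst (λ x → x * (x * x) + 51 * (m * m) ≤ 27 * (m * (m * m)) + 17 * (x * x))
         (sym (m≡m%n+[m/n]*n n 3)) (cube-bound m (m%n<n n 3)) ⟩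
  27 * (m * (m * m)) + 17 * (n * n)
    ≡⟨ cong (_+ 17 * (n * n)) (split m) ⟩
  4 * (m * (m * (m * 6))) + 3 * (m * (m * m)) + 17 * (n * n)
    -- Three copies of the error 17m² of the level below make up the 51m² added to both sides.
    ≤⟨ +-monoˡ-≤ _ (+-monoʳ-≤ (4 * (m * (m * (m * 6)))) (*-monoʳ-≤ 3 (count-lower h m m≤h))) ⟩
  4 * (m * (m * (m * 6))) + 3 * (4 * count h m + 17 * (m * m)) + 17 * (n * n)
    ≡⟨ regroup (m * (m * (m * 6))) (count h m) (m * m) (17 * (n * n)) ⟩
  4 * (m * (m * (m * 6)) + 3 * count h m) + 17 * (n * n) + 51 * (m * m)
    ≡⟨ cong (λ z → 4 * z + 17 * (n * n) + 51 * (m * m)) (count-blocks h m) ⟨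
  4 * count (suc h) (m * 3) + 17 * (n * n) + 51 * (m * m)
    ≤⟨ +-monoˡ-≤ _ (+-monoˡ-≤ _ (*-monoʳ-≤ 4 (count-mono (suc h) (m/n*n≤m n 3)))) ⟩
  4 * count (suc h) n + 17 * (n * n) + 51 * (m * m) ∎)
  where
  open ≤-Reasoning
  m : ℕ
  m = n ℕ./ 3
  m≤h : m ≤ h
  -- One level fewer suffices for `m`, since `n` is positive and so n / 3 < n.
  m≤h = ≤-trans (s≤s⁻¹ (m/n<m n 3 (s≤s (s≤s z≤n)))) n≤h
  split : ∀ m → 27 * (m * (m * m)) ≡ 4 * (m * (m * (m * 6))) + 3 * (m * (m * m))
  split = solve-∀
  regroup : ∀ a c b d → 4 * a + 3 * (4 * c + 17 * b) + d ≡ 4 * (a + 3 * c) + d + 51 * b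
  regroup = solve-∀

-- Ordered triples and three-element subsets

insert-size-≤ : ∀ {n} (x : Fin n) p → ∣ ⁅ x ⁆ ∪ p ∣ ≤ suc ∣ p ∣
insert-size-≤ zero    (inside  ∷ p) rewrite ∪-identityˡ p = s≤s (n≤1+n _)
insert-size-≤ zero    (outside ∷ p) rewrite ∪-identityˡ p = ≤-refl
insert-size-≤ (suc x) (inside  ∷ p) = s≤s (insert-size-≤ x p)
insert-size-≤ (suc x) (outside ∷ p) = insert-size-≤ x p

remove-size : ∀ {n} {x : Fin n} {p} → x ∈ₛ p → suc ∣ p - x ∣ ≡ ∣ p ∣
remove-size {x = zero}  {inside  ∷ p} x∈p = cong (suc ∘ ∣_∣) (p─⊥≡p p)
remove-size {x = suc x} {inside  ∷ p} (Vec.there x∈p) = cong suc (remove-size x∈p)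
remove-size {x = suc x} {outside ∷ p} (Vec.there x∈p) = remove-size x∈p

insert-remove : ∀ {n} {x : Fin n} {p} → x ∈ₛ p → ⁅ x ⁆ ∪ (p - x) ≡ p
insert-remove {x = zero}  {inside  ∷ p} x∈p = cong (inside ∷_) (trans (∪-identityˡ _) (p─⊥≡p p))
insert-remove {x = suc x} {inside  ∷ p} (Vec.there x∈p) = cong (inside ∷_) (insert-remove x∈p)
insert-remove {x = suc x} {outside ∷ p} (Vec.there x∈p) = cong (outside ∷_) (insert-remove x∈p)

remove-insert : ∀ {n} {x : Fin n} {p} → x ∉ₛ p → (⁅ x ⁆ ∪ p) - x ≡ p
remove-insert {x = zero}  {inside  ∷ p} x∉p = contradiction Vec.here x∉p
remove-insert {x = zero}  {outside ∷ p} x∉p = cong (outside ∷_) (trans (p─⊥≡p _) (∪-identityˡ p))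
remove-insert {x = suc x} {inside  ∷ p} x∉p = cong (inside ∷_) (remove-insert (x∉p ∘ Vec.there))
remove-insert {x = suc x} {outside ∷ p} x∉p = cong (outside ∷_) (remove-insert (x∉p ∘ Vec.there))

insert-size : ∀ {n} {x : Fin n} {p} → x ∉ₛ p → ∣ ⁅ x ⁆ ∪ p ∣ ≡ suc ∣ p ∣
insert-size {x = x} {p} x∉p = trans (sym (remove-size (x∈p∪q⁺ (inj₁ (x∈⁅x⁆ x)))))
  (cong (suc ∘ ∣_∣) (remove-insert x∉p))

size-0 : ∀ {n} {p : Subset n} → ∣ p ∣ ≡ 0 → p ≡ ∅
size-0 {p = p} ∣p∣≡0 = Empty-unique λ { (x , x∈p) → 1+n≢0 (trans (remove-size x∈p) ∣p∣≡0) }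

module _ {n : ℕ} where

  triple-swap₁₂ : ∀ (a b c : Fin n) → triple a b c ≡ triple b a c
  triple-swap₁₂ a b c = trans (sym (∪-assoc ⁅ a ⁆ ⁅ b ⁆ ⁅ c ⁆))
    (trans (cong (_∪ ⁅ c ⁆) (∪-comm ⁅ a ⁆ ⁅ b ⁆)) (∪-assoc ⁅ b ⁆ ⁅ a ⁆ ⁅ c ⁆))

  triple-swap₂₃ : ∀ (a b c : Fin n) → triple a b c ≡ triple a c b
  triple-swap₂₃ a b c = cong (⁅ a ⁆ ∪_) (∪-comm ⁅ b ⁆ ⁅ c ⁆)

  ∈-pair : ∀ {x} (a b : Fin n) → x ∈ₛ ⁅ a ⁆ ∪ ⁅ b ⁆ → x ≡ a ⊎ x ≡ b
  ∈-pair a b = Sum.map (x∈⁅y⁆⇒x≡y a) (x∈⁅y⁆⇒x≡y b) ∘ x∈p∪q⁻ ⁅ a ⁆ ⁅ b ⁆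

  ∈-triple : ∀ {x} (a b c : Fin n) → x ∈ₛ triple a b c → x ≡ a ⊎ x ≡ b ⊎ x ≡ c
  ∈-triple a b c = Sum.map (x∈⁅y⁆⇒x≡y a) (∈-pair b c) ∘ x∈p∪q⁻ ⁅ a ⁆ (⁅ b ⁆ ∪ ⁅ c ⁆)

  ∈-triple₁ : ∀ (a b c : Fin n) → a ∈ₛ triple a b c
  ∈-triple₁ a b c = x∈p∪q⁺ (inj₁ (x∈⁅x⁆ a))

  Distinct : Fin n → Fin n → Fin n → Set
  Distinct a b c = a ≢ b × b ≢ c × a ≢ c

  private
    ∉-pair : ∀ {a b c : Fin n} → Distinct a b c → a ∉ₛ ⁅ b ⁆ ∪ ⁅ c ⁆
    ∉-pair {a} {b} {c} (a≢b , _ , a≢c) a∈ with ∈-pair b c a∈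
    ... | inj₁ a≡b = a≢b a≡b
    ... | inj₂ a≡c = a≢c a≡c

    ∉-singleton : ∀ {b c : Fin n} → b ≢ c → b ∉ₛ ⁅ c ⁆
    ∉-singleton {c = c} b≢c b∈ = b≢c (x∈⁅y⁆⇒x≡y c b∈)

  triple-size : ∀ {a b c : Fin n} → Distinct a b c → ∣ triple a b c ∣ ≡ 3
  triple-size {a} {b} {c} abc@(_ , b≢c , _) =
    trans (insert-size (∉-pair abc)) (cong suc (trans (insert-size (∉-singleton b≢c)) (cong suc (∣⁅x⁆∣≡1 c))))

  private
    degenerate : ∀ (a c : Fin n) → ∣ triple a c c ∣ ≢ 3
    degenerate a c eq = 1+n≰n (begin
      3                     ≡⟨ eq ⟨
      ∣ triple a c c ∣      ≡⟨ cong (λ p → ∣ ⁅ a ⁆ ∪ p ∣) (∪-idem ⁅ c ⁆) ⟩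
      ∣ ⁅ a ⁆ ∪ ⁅ c ⁆ ∣     ≤⟨ insert-size-≤ a ⁅ c ⁆ ⟩
      suc ∣ ⁅ c ⁆ ∣         ≡⟨ cong suc (∣⁅x⁆∣≡1 c) ⟩
      2                     ∎)
      where open ≤-Reasoning

  triple-distinct : ∀ (a b c : Fin n) → ∣ triple a b c ∣ ≡ 3 → Distinct a b c
  triple-distinct a b c eq =
    (λ { refl → degenerate c a (trans (cong ∣_∣ (trans (triple-swap₁₂ c a a) (triple-swap₂₃ a c a))) eq) }) ,
    (λ { refl → degenerate a b eq }) ,
    (λ { refl → degenerate b a (trans (cong ∣_∣ (triple-swap₁₂ b a a)) eq) })

  -- The orderings of a three-element set are the draws of its elements without replacement. This
  -- and its converse `pick-triple` make the indicator of an ordering a product that can be summed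
  -- one variable at a time.
  triple-pick : ∀ {a b c : Fin n} {s : Subset n} → ∣ s ∣ ≡ 3 → triple a b c ≡ s → a ∈ₛ s × b ∈ₛ s - a × c ∈ₛ s - a - b
  triple-pick {a} {b} {c} size refl = ∈-triple₁ a b c ,
    subst (b ∈ₛ_) (sym minus-a) (x∈p∪q⁺ (inj₁ (x∈⁅x⁆ b))) ,
    subst (c ∈ₛ_) (sym (trans (cong (_- b) minus-a) (remove-insert (∉-singleton b≢c)))) (x∈⁅x⁆ c)
    where
    abc : Distinct a b c
    abc = triple-distinct a b c size
    b≢c : b ≢ c
    b≢c = proj₁ (proj₂ abc)
    minus-a : triple a b c - a ≡ ⁅ b ⁆ ∪ ⁅ c ⁆
    minus-a = remove-insert (∉-pair abc)

  -- Three draws leave a set of size 0, and putting the drawn elements back into the empty set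
  -- restores `s`.
  pick-triple : ∀ {a b c : Fin n} {s : Subset n} → ∣ s ∣ ≡ 3 → a ∈ₛ s → b ∈ₛ s - a → c ∈ₛ s - a - b → triple a b c ≡ s
  pick-triple {a} {b} {c} {s} size a∈ b∈ c∈ = begin
    ⁅ a ⁆ ∪ (⁅ b ⁆ ∪ ⁅ c ⁆)                       ≡⟨ cong (λ p → ⁅ a ⁆ ∪ (⁅ b ⁆ ∪ p)) (∪-identityʳ ⁅ c ⁆) ⟨
    ⁅ a ⁆ ∪ (⁅ b ⁆ ∪ (⁅ c ⁆ ∪ ∅))                 ≡⟨ cong (λ p → ⁅ a ⁆ ∪ (⁅ b ⁆ ∪ (⁅ c ⁆ ∪ p))) (size-0 empty) ⟨
    ⁅ a ⁆ ∪ (⁅ b ⁆ ∪ (⁅ c ⁆ ∪ (s - a - b - c)))   ≡⟨ cong (λ p → ⁅ a ⁆ ∪ (⁅ b ⁆ ∪ p)) (insert-remove c∈) ⟩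
    ⁅ a ⁆ ∪ (⁅ b ⁆ ∪ (s - a - b))                 ≡⟨ cong (⁅ a ⁆ ∪_) (insert-remove b∈) ⟩
    ⁅ a ⁆ ∪ (s - a)                               ≡⟨ insert-remove a∈ ⟩
    s                                             ∎
    where
    open ≡-Reasoning
    empty : ∣ s - a - b - c ∣ ≡ 0
    empty = +-cancelˡ-≡ 3 _ _ (trans (cong (2 +_) (remove-size c∈))
      (trans (cong suc (remove-size b∈)) (trans (remove-size a∈) size)))

  _≟ₛ_ : DecidableEquality (Subset n)
  _≟ₛ_ = VecP.≡-dec Bool._≟_

  triple≡-factors : ∀ {s : Subset n} → ∣ s ∣ ≡ 3 → ∀ (a b c : Fin n) → ⟦ does (triple a b c ≟ₛ s) ⟧ ≡
                    ⟦ lookup s a ⟧ * (⟦ lookup (s - a) b ⟧ * ⟦ lookup (s - a - b) c ⟧)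
  triple≡-factors {s} size a b c = factors (triple a b c ≟ₛ s)
    (λ eq → let a∈ , b∈ , c∈ = triple-pick {s = s} size eq in
      VecP.[]=⇒lookup a∈ , VecP.[]=⇒lookup b∈ , VecP.[]=⇒lookup c∈)
    (λ a∈ b∈ c∈ → pick-triple {s = s} size (VecP.lookup⇒[]= a s a∈)
      (VecP.lookup⇒[]= b (s - a) b∈) (VecP.lookup⇒[]= c (s - a - b) c∈))
    where
    factors : ∀ {P : Set} (P? : Dec P) {x y z} → (P → x ≡ true × y ≡ true × z ≡ true) →
              (x ≡ true → y ≡ true → z ≡ true → P) → ⟦ does P? ⟧ ≡ ⟦ x ⟧ * (⟦ y ⟧ * ⟦ z ⟧)
    factors (yes p) to from with refl , refl , refl ← to p = refl
    factors (no ¬p) {false}                to from = refl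
    factors (no ¬p) {true} {false}         to from = refl
    factors (no ¬p) {true} {true}  {false} to from = refl
    factors (no ¬p) {true} {true}  {true}  to from = contradiction (from refl refl refl) ¬p

∑-lookup : ∀ {n} (p : Subset n) → ∑[ x < n ] ⟦ lookup p x ⟧ ≡ ∣ p ∣
∑-lookup []            = refl
∑-lookup (inside  ∷ p) = cong suc (∑-lookup p)
∑-lookup (outside ∷ p) = ∑-lookup p

∑-members : ∀ {n k} (p : Subset n) (f : Fin n → ℕ) → (∀ x → x ∈ₛ p → f x ≡ k) →
            ∑[ x < n ] (⟦ lookup p x ⟧ * f x) ≡ ∣ p ∣ * k
∑-members {n} {k} p f f≡k = begin
  ∑[ x < n ] (⟦ lookup p x ⟧ * f x)  ≡⟨ sum-cong-≗ term ⟩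
  ∑[ x < n ] (⟦ lookup p x ⟧ * k)    ≡⟨ *-distribʳ-sum k (λ x → ⟦ lookup p x ⟧) ⟨
  sum (λ x → ⟦ lookup p x ⟧) * k     ≡⟨ cong (_* k) (∑-lookup p) ⟩
  ∣ p ∣ * k                          ∎
  where
  open ≡-Reasoning
  term : ∀ x → ⟦ lookup p x ⟧ * f x ≡ ⟦ lookup p x ⟧ * k
  term x with lookup p x in eq
  ... | false = refl
  ... | true  = cong (_+ 0) (f≡k x (VecP.lookup⇒[]= x p eq))

-- There are 3 choices for `a`, then 2 for `b`, then 1 for `c`.
orderings : ∀ {n} {s : Subset n} → ∣ s ∣ ≡ 3 → ∑³ (λ a b c → ⟦ does (triple a b c ≟ₛ s) ⟧) ≡ 6
orderings {n} {s} size = begin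
  ∑³ (λ a b c → ⟦ does (triple a b c ≟ₛ s) ⟧)
    ≡⟨ ∑³-cong (triple≡-factors {n} {s} size) ⟩
  ∑³ (λ a b c → ⟦ lookup s a ⟧ * (⟦ lookup (s - a) b ⟧ * ⟦ lookup (s - a - b) c ⟧))
    ≡⟨ (sum-cong-≗ λ a → trans
         (sum-cong-≗ λ b → sym (*-distribˡ-sum ⟦ lookup s a ⟧ λ c → ⟦ lookup (s - a) b ⟧ * ⟦ lookup (s - a - b) c ⟧))
         (sym (*-distribˡ-sum ⟦ lookup s a ⟧ λ b → ∑[ c < n ] (⟦ lookup (s - a) b ⟧ * ⟦ lookup (s - a - b) c ⟧)))) ⟩
  ∑[ a < n ] (⟦ lookup s a ⟧ * (∑[ b < n ] ∑[ c < n ] (⟦ lookup (s - a) b ⟧ * ⟦ lookup (s - a - b) c ⟧)))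
    ≡⟨ ∑-members s _ inner ⟩
  ∣ s ∣ * 2
    ≡⟨ cong (_* 2) size ⟩
  6 ∎
  where
  open ≡-Reasoning
  inner : ∀ a → a ∈ₛ s → ∑[ b < n ] ∑[ c < n ] (⟦ lookup (s - a) b ⟧ * ⟦ lookup (s - a - b) c ⟧) ≡ 2
  inner a a∈ = begin
    ∑[ b < n ] ∑[ c < n ] (⟦ lookup (s - a) b ⟧ * ⟦ lookup (s - a - b) c ⟧)
      ≡⟨ (sum-cong-≗ λ b → *-distribˡ-sum ⟦ lookup (s - a) b ⟧ λ c → ⟦ lookup (s - a - b) c ⟧) ⟨
    ∑[ b < n ] (⟦ lookup (s - a) b ⟧ * (∑[ c < n ] ⟦ lookup (s - a - b) c ⟧))
      ≡⟨ ∑-members (s - a) _ (λ b b∈ → trans (∑-lookup (s - a - b)) (suc-injective (trans (remove-size b∈) size-a))) ⟩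
    ∣ s - a ∣ * 1
      ≡⟨ cong (_* 1) size-a ⟩
    2 ∎
    where
    size-a : ∣ s - a ∣ ≡ 2
    size-a = suc-injective (trans (remove-size a∈) size)

-- Three-graphs as ternary relations

module _ {n : ℕ} where
  open DecMembership (_≟ₛ_ {n}) using (_∈?_)

  adjacent : ThreeGraph n → Fin n → Fin n → Fin n → Bool
  adjacent G a b c = does (triple a b c ∈? edges G)

  private
    -- As `s` does not recur in `L`, at most one of the two indicators is 1. This is where the
    -- distinctness of the edges enters the count.
    ∈?-∷ : ∀ t {s : Subset n} {L} → All (s ≢_) L → ⟦ does (t ∈? (s ∷ L)) ⟧ ≡ ⟦ does (t ≟ₛ s) ⟧ + ⟦ does (t ∈? L) ⟧
    ∈?-∷ t {s} {L} s∉L with t ≟ₛ s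
    ... | no _     = refl
    ... | yes refl = cong (suc ∘ ⟦_⟧) (sym (dec-false (t ∈? L) λ t∈L → All.lookup s∉L t∈L refl))

    ∑-∈? : ∀ (L : List (Subset n)) → Unique L → All (λ s → ∣ s ∣ ≡ 3) L →
           ∑³ (λ a b c → ⟦ does (triple a b c ∈? L) ⟧) ≡ length L * 6
    ∑-∈? []      _            _            = trans (sum-cong-≗ {n} λ _ → trans (sum-cong-≗ {n} λ _ → zeros) zeros) zeros
      where
      zeros : ∑[ i < n ] 0 ≡ 0
      zeros = trans (sum-const n 0) (*-zeroʳ n)
    ∑-∈? (s ∷ L) (s∉L ∷ uniq) (size ∷ sizes) = begin
      ∑³ (λ a b c → ⟦ does (triple a b c ∈? (s ∷ L)) ⟧)
        ≡⟨ ∑³-cong (λ a b c → ∈?-∷ (triple a b c) s∉L) ⟩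
      ∑³ (λ a b c → ⟦ does (triple a b c ≟ₛ s) ⟧ + ⟦ does (triple a b c ∈? L) ⟧)
        ≡⟨ ∑³-+ (λ a b c → ⟦ does (triple a b c ≟ₛ s) ⟧) (λ a b c → ⟦ does (triple a b c ∈? L) ⟧) ⟩
      ∑³ (λ a b c → ⟦ does (triple a b c ≟ₛ s) ⟧) + ∑³ (λ a b c → ⟦ does (triple a b c ∈? L) ⟧)
        ≡⟨ cong₂ _+_ (orderings {n} {s} size) (∑-∈? L uniq sizes) ⟩
      6 + length L * 6 ∎
      where open ≡-Reasoning

  adjacent-count : ∀ G → ∑³ (λ a b c → ⟦ adjacent G a b c ⟧) ≡ e G * 6
  adjacent-count G = ∑-∈? (edges G) (distinct G) (size3 G)

  private
    adjacent⇒∈ : ∀ (G : ThreeGraph n) {a b c : Fin n} → adjacent G a b c ≡ true → triple a b c ∈ edges G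
    adjacent⇒∈ G {a} {b} {c} eq with triple a b c ∈? edges G
    ... | yes t∈ = t∈

    edge-distinct : ∀ (G : ThreeGraph n) {a b c : Fin n} → triple a b c ∈ edges G → Distinct a b c
    edge-distinct G t∈ = triple-distinct _ _ _ (All.lookup (size3 G) t∈)

  adjacent-free : ∀ G → ¬ Contains G C5minus → IsC₅⁻-free (adjacent G)
  adjacent-free G free = record
    { swap₁₂ = λ a b c → cong (λ t → does (t ∈? edges G)) (triple-swap₁₂ a b c)
    ; swap₂₃ = λ a b c → cong (λ t → does (t ∈? edges G)) (triple-swap₂₃ a b c)
    ; free   = λ b≢e abc bcd cde dea →
        embed b≢e (adjacent⇒∈ G abc) (adjacent⇒∈ G bcd) (adjacent⇒∈ G cde) (adjacent⇒∈ G dea)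
    }
    where
    embed : ∀ {a b c d e : Fin n} → b ≢ e → triple a b c ∈ edges G → triple b c d ∈ edges G →
            triple c d e ∈ edges G → triple d e a ∈ edges G → ⊥
    embed {a} {b} {c} {d} {e} b≢e abc bcd cde dea =
      let a≢b , b≢c , a≢c = edge-distinct G abc
          _   , c≢d , b≢d = edge-distinct G bcd
          _   , d≢e , c≢e = edge-distinct G cde
          _   , e≢a , d≢a = edge-distinct G dea
          unique = (a≢b V.∷ a≢c V.∷ ≢-sym d≢a V.∷ ≢-sym e≢a V.∷ V.[]) VP.∷
                   (b≢c V.∷ b≢d V.∷ b≢e V.∷ V.[]) VP.∷
                   (c≢d V.∷ c≢e V.∷ V.[]) VP.∷ (d≢e V.∷ V.[]) VP.∷ V.[] VP.∷ VP.[]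
      in free (lookup (a ∷ b ∷ c ∷ d ∷ e ∷ []) , (λ {i} {j} → lookup-injective unique i j) ,
               abc ∷ bcd ∷ cde ∷ dea ∷ [])

-- The iterated blow-up as a three-graph

module _ (n : ℕ) where
  open DecMembership (_≟ₛ_ {n}) using (_∈?_)

  private
    -- Depth `n` is enough, since numbers below `n` have at most `n` base-3 digits.
    nestedAt : Fin n → Fin n → Fin n → Bool
    nestedAt a b c = nested n (toℕ a) (toℕ b) (toℕ c)

    swap₁₂ : ∀ {a b c} → nestedAt a b c ≡ true → nestedAt b a c ≡ true
    swap₁₂ {a} {b} {c} = trans (nested-swap₁₂ n (toℕ b) (toℕ a) (toℕ c))

    swap₂₃ : ∀ {a b c} → nestedAt a b c ≡ true → nestedAt a c b ≡ true
    swap₂₃ {a} {b} {c} = trans (nested-swap₂₃ n (toℕ a) (toℕ c) (toℕ b))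

    nested-distinct : ∀ {a b c} → nestedAt a b c ≡ true → Distinct a b c
    nested-distinct {a} {b} {c} p =
      (λ { refl → nested-irreflexive n {toℕ a} {toℕ c} p }) ,
      (λ { refl → nested-irreflexive n {toℕ b} {toℕ a} (swap₂₃ {b} {a} {b} (swap₁₂ {a} {b} {b} p)) }) ,
      (λ { refl → nested-irreflexive n {toℕ a} {toℕ b} (swap₂₃ {a} {b} {a} p) })

    -- A set in the edge list comes with some ordering x, y, z, perhaps not the one asked about.
    -- Distinct a, b, c among x, y, z are a permutation of them, which the two swaps generate; all
    -- other cases repeat a vertex.
    rearrange : ∀ {a b c x y z} → Distinct a b c → a ≡ x ⊎ a ≡ y ⊎ a ≡ z →
                b ≡ x ⊎ b ≡ y ⊎ b ≡ z → c ≡ x ⊎ c ≡ y ⊎ c ≡ z →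
                nestedAt x y z ≡ true → nestedAt a b c ≡ true
    rearrange (a≢b , b≢c , a≢c) (inj₁ refl) (inj₂ (inj₁ refl)) (inj₂ (inj₂ refl)) p = p
    rearrange {a} {b} {c} (a≢b , b≢c , a≢c) (inj₁ refl) (inj₂ (inj₂ refl)) (inj₂ (inj₁ refl)) p = swap₂₃ {a} {c} {b} p
    rearrange {a} {b} {c} (a≢b , b≢c , a≢c) (inj₂ (inj₁ refl)) (inj₁ refl) (inj₂ (inj₂ refl)) p = swap₁₂ {b} {a} {c} p
    rearrange {a} {b} {c} (a≢b , b≢c , a≢c) (inj₂ (inj₁ refl)) (inj₂ (inj₂ refl)) (inj₁ refl) p =
      swap₂₃ {a} {c} {b} (swap₁₂ {c} {a} {b} p)
    rearrange {a} {b} {c} (a≢b , b≢c , a≢c) (inj₂ (inj₂ refl)) (inj₁ refl) (inj₂ (inj₁ refl)) p =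
      swap₁₂ {b} {a} {c} (swap₂₃ {b} {c} {a} p)
    rearrange {a} {b} {c} (a≢b , b≢c , a≢c) (inj₂ (inj₂ refl)) (inj₂ (inj₁ refl)) (inj₁ refl) p =
      swap₁₂ {b} {a} {c} (swap₂₃ {b} {c} {a} (swap₁₂ {c} {b} {a} p))
    rearrange (a≢b , _) (inj₁ refl) (inj₁ refl) _ _ = contradiction refl a≢b
    rearrange (a≢b , _) (inj₂ (inj₁ refl)) (inj₂ (inj₁ refl)) _ _ = contradiction refl a≢b
    rearrange (a≢b , _) (inj₂ (inj₂ refl)) (inj₂ (inj₂ refl)) _ _ = contradiction refl a≢b
    rearrange (_ , b≢c , _) _ (inj₁ refl) (inj₁ refl) _ = contradiction refl b≢c
    rearrange (_ , b≢c , _) _ (inj₂ (inj₁ refl)) (inj₂ (inj₁ refl)) _ = contradiction refl b≢c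
    rearrange (_ , b≢c , _) _ (inj₂ (inj₂ refl)) (inj₂ (inj₂ refl)) _ = contradiction refl b≢c
    rearrange (_ , _ , a≢c) (inj₁ refl) _ (inj₁ refl) _ = contradiction refl a≢c
    rearrange (_ , _ , a≢c) (inj₂ (inj₁ refl)) _ (inj₂ (inj₁ refl)) _ = contradiction refl a≢c
    rearrange (_ , _ , a≢c) (inj₂ (inj₂ refl)) _ (inj₂ (inj₂ refl)) _ = contradiction refl a≢c

    toTriple : Fin n × Fin n × Fin n → Subset n
    toTriple (a , b , c) = triple a b c

    isNested? : (t : Fin n × Fin n × Fin n) → Dec (nestedAt (proj₁ t) (proj₁ (proj₂ t)) (proj₂ (proj₂ t)) ≡ true)
    isNested? (a , b , c) = nestedAt a b c Bool.≟ true

    candidates : List (Fin n × Fin n × Fin n)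
    candidates = cartesianProduct (allFin n) (cartesianProduct (allFin n) (allFin n))

    -- Each edge arises from six orderings, so the duplicates have to go.
    nestedEdges : List (Subset n)
    nestedEdges = deduplicate _≟ₛ_ (map toTriple (filter isNested? candidates))

    nested⇒∈ : ∀ a b c → nestedAt a b c ≡ true → triple a b c ∈ nestedEdges
    nested⇒∈ a b c p = ∈-deduplicate⁺ _≟ₛ_ (∈-map⁺ toTriple (∈-filter⁺ isNested?
      (∈-cartesianProduct⁺ (∈-allFin a) (∈-cartesianProduct⁺ (∈-allFin b) (∈-allFin c))) p))

    ∈⇒triple : ∀ {s} → s ∈ nestedEdges → ∃[ x ] ∃[ y ] ∃[ z ] (nestedAt x y z ≡ true × s ≡ triple x y z)
    ∈⇒triple s∈ =
      let (x , y , z) , t∈ , s≡ = ∈-map⁻ toTriple (∈-deduplicate⁻ _≟ₛ_ (map toTriple (filter isNested? candidates)) s∈)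
      in x , y , z , proj₂ (∈-filter⁻ isNested? {xs = candidates} t∈) , s≡

    edge-size : ∀ {s} → s ∈ nestedEdges → ∣ s ∣ ≡ 3
    edge-size s∈ = let x , y , z , p , s≡ = ∈⇒triple s∈ in
      trans (cong ∣_∣ s≡) (triple-size (nested-distinct p))

    ∈⇒nested : ∀ a b c → triple a b c ∈ nestedEdges → nestedAt a b c ≡ true
    ∈⇒nested a b c t∈ = let x , y , z , p , t≡ = ∈⇒triple t∈ in
      rearrange (triple-distinct a b c (edge-size t∈))
        (∈-triple x y z (subst (a ∈ₛ_) t≡ (∈-triple₁ a b c)))
        (∈-triple x y z (subst (b ∈ₛ_) (trans (triple-swap₁₂ b a c) t≡) (∈-triple₁ b a c)))
        (∈-triple x y z (subst (c ∈ₛ_) (trans (triple-swap₁₂ c a b) (trans (triple-swap₂₃ a c b) t≡)) (∈-triple₁ c a b)))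
        p

  nestedGraph : ThreeGraph n
  nestedGraph = record
    { edges    = nestedEdges
    ; distinct = DecUnique.deduplicate-! _≟ₛ_ (map toTriple (filter isNested? candidates))
    ; size3    = All.tabulate edge-size
    }

  nestedGraph-free : ¬ Contains nestedGraph C5minus
  nestedGraph-free (φ , _ , abc ∷ bcd ∷ cde ∷ dea ∷ []) =
    nested-free n (∈⇒nested _ _ _ abc) (∈⇒nested _ _ _ bcd) (∈⇒nested _ _ _ cde) (∈⇒nested _ _ _ dea)

  nestedGraph-count : count n n ≤ e nestedGraph * 6
  nestedGraph-count = ≤-trans (∑³-mono {n} bound) (≤-reflexive (adjacent-count nestedGraph))
    where
    bound : ∀ a b c → ⟦ nestedAt a b c ⟧ ≤ ⟦ adjacent nestedGraph a b c ⟧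
    bound a b c with nestedAt a b c in eq
    ... | false = z≤n
    ... | true  = ≤-reflexive (sym (cong ⟦_⟧ (dec-true (triple a b c ∈? nestedEdges) (nested⇒∈ a b c eq))))

-- The limit

open import Data.Integer using (+_; +[1+_]; -[1+_])

edge-upper : ∀ {n} k → 2 ≤ k → k * k * k ≤ n → (G : ThreeGraph n) → ¬ Contains G C5minus →
             k * (24 * e G) ≤ (k + 9) * (n * (n * n))
edge-upper {n} k 2≤k k³≤n G free = subst (λ x → k * x ≤ (k + 9) * (n * (n * n)))
  (trans (cong (4 *_) (adjacent-count G)) (regroup (e G)))
  (edge-density (adjacent-free G free) k 2≤k k³≤n)
  where
  regroup : ∀ x → 4 * (x * 6) ≡ 24 * x
  regroup = solve-∀

edge-lower : ∀ n → n * (n * n) ≤ 24 * e (nestedGraph n) + 17 * (n * n)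
edge-lower n = begin
  n * (n * n)                                   ≤⟨ count-lower n n ≤-refl ⟩
  4 * count n n + 17 * (n * n)                  ≤⟨ +-monoˡ-≤ _ (*-monoʳ-≤ 4 (nestedGraph-count n)) ⟩
  4 * (e (nestedGraph n) * 6) + 17 * (n * n)    ≡⟨ cong (_+ 17 * (n * n)) (regroup (e (nestedGraph n))) ⟩
  24 * e (nestedGraph n) + 17 * (n * n)         ∎
  where
  open ≤-Reasoning
  regroup : ∀ x → 4 * (x * 6) ≡ 24 * x
  regroup = solve-∀

-- Binomial coefficients against cubes

choose-2 : ∀ j → 2 * ((2 + j) C 2) ≡ (2 + j) * (1 + j)
choose-2 zero    = refl
choose-2 (suc j) = begin
  2 * ((3 + j) C 2)                          ≡⟨ cong (2 *_) (nCk+nC[k+1]≡[n+1]C[k+1] (2 + j) 1) ⟨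
  2 * ((2 + j) C 1 + (2 + j) C 2)            ≡⟨ cong (λ x → 2 * (x + (2 + j) C 2)) (nC1≡n (2 + j)) ⟩
  2 * (2 + j + (2 + j) C 2)                  ≡⟨ *-distribˡ-+ 2 (2 + j) _ ⟩
  2 * (2 + j) + 2 * ((2 + j) C 2)            ≡⟨ cong (λ x → 2 * (2 + j) + x) (choose-2 j) ⟩
  2 * (2 + j) + (2 + j) * (1 + j)            ≡⟨ factor j ⟩
  (3 + j) * (2 + j)                          ∎
  where
  open ≡-Reasoning
  factor : ∀ j → 2 * (2 + j) + (2 + j) * (1 + j) ≡ (3 + j) * (2 + j)
  factor = solve-∀

choose-3 : ∀ j → 6 * ((3 + j) C 3) ≡ (3 + j) * ((2 + j) * (1 + j))
choose-3 zero    = refl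
choose-3 (suc j) = begin
  6 * ((4 + j) C 3)                                          ≡⟨ cong (6 *_) (nCk+nC[k+1]≡[n+1]C[k+1] (3 + j) 2) ⟨
  6 * ((3 + j) C 2 + (3 + j) C 3)                            ≡⟨ expand ((3 + j) C 2) ((3 + j) C 3) ⟩
  3 * (2 * ((3 + j) C 2)) + 6 * ((3 + j) C 3)                ≡⟨ cong₂ (λ x y → 3 * x + y) (choose-2 (suc j)) (choose-3 j) ⟩
  3 * ((3 + j) * (2 + j)) + (3 + j) * ((2 + j) * (1 + j))    ≡⟨ factor j ⟩
  (4 + j) * ((3 + j) * (2 + j))                              ∎
  where
  open ≡-Reasoning
  expand : ∀ x y → 6 * (x + y) ≡ 3 * (2 * x) + 6 * y
  expand = solve-∀
  factor : ∀ j → 3 * ((3 + j) * (2 + j)) + (3 + j) * ((2 + j) * (1 + j)) ≡ (4 + j) * ((3 + j) * (2 + j))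
  factor = solve-∀

-- This is n(n - 1)(n - 2) = n³ - 3n² + 2n with the negative term moved across.
cube-C : ∀ {n} → 3 ≤ n → n * (n * n) + 2 * n ≡ 6 * (n C 3) + 3 * (n * n)
cube-C 3≤n with j , refl ← m≤n⇒∃[o]m+o≡n 3≤n = trans (expand j) (cong (_+ 3 * ((3 + j) * (3 + j))) (sym (choose-3 j)))
  where
  expand : ∀ j → (3 + j) * ((3 + j) * (3 + j)) + 2 * (3 + j) ≡
                 (3 + j) * ((2 + j) * (1 + j)) + 3 * ((3 + j) * (3 + j))
  expand = solve-∀

module _ {n : ℕ} (6≤n : 6 ≤ n) where

  private
    3≤n : 3 ≤ n
    3≤n = ≤-trans (s≤s (s≤s (s≤s z≤n))) 6≤n

  6C≤cube : 6 * (n C 3) ≤ n * (n * n)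
  6C≤cube = +-cancelʳ-≤ (3 * (n * n)) _ _ (begin
    6 * (n C 3) + 3 * (n * n)   ≡⟨ cube-C 3≤n ⟨
    n * (n * n) + 2 * n         ≤⟨ +-monoʳ-≤ (n * (n * n)) (*-mono-≤ {2} {3} (s≤s (s≤s z≤n))
                                     (m≤m*n n n {{>-nonZero (≤-trans (s≤s z≤n) 6≤n)}})) ⟩
    n * (n * n) + 3 * (n * n)   ∎)
    where open ≤-Reasoning

  cube≤6C : n * (n * n) ≤ 6 * (n C 3) + 3 * (n * n)
  cube≤6C = ≤-trans (m≤m+n _ (2 * n)) (≤-reflexive (cube-C 3≤n))

  -- Twice `cube≤6C` has the error 6n², which is at most n³ by `6≤n`.
  cube≤12C : n * (n * n) ≤ 12 * (n C 3)
  cube≤12C = +-cancelʳ-≤ (n * (n * n)) _ _ (begin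
    n * (n * n) + n * (n * n)                 ≤⟨ +-mono-≤ cube≤6C cube≤6C ⟩
    6 * (n C 3) + 3 * (n * n) + (6 * (n C 3) + 3 * (n * n))
                                              ≡⟨ regroup (n C 3) (n * n) ⟩
    12 * (n C 3) + 6 * (n * n)                ≤⟨ +-monoʳ-≤ (12 * (n C 3)) (*-monoˡ-≤ (n * n) 6≤n) ⟩
    12 * (n C 3) + n * (n * n)                ∎)
    where
    open ≤-Reasoning
    regroup : ∀ c s → 6 * c + 3 * s + (6 * c + 3 * s) ≡ 12 * c + 6 * s
    regroup = solve-∀

module _ (n q : ℕ) (17k≤n : 17 * (6 * suc q) ≤ n) where

  private
    -- Here `suc q` will be the denominator of ε; the factor 6 keeps the loss of order n³/k within
    -- the tolerance.
    k c : ℕ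
    k = 6 * suc q
    c = n C 3

    6≤k : 6 ≤ k
    6≤k = *-monoʳ-≤ 6 {1} (s≤s z≤n)

    6≤n : 6 ≤ n
    6≤n = ≤-trans 6≤k (≤-trans (m≤n*m k 17) 17k≤n)

    17kn²≤n³ : 17 * k * (n * n) ≤ n * (n * n)
    17kn²≤n³ = *-monoˡ-≤ (n * n) 17k≤n

  C>0 : 0 < n C 3
  C>0 = *-cancelˡ-< 12 0 c (<-≤-trans (*-mono-< 0<n (*-mono-< 0<n 0<n)) (cube≤12C 6≤n))
    where
    0<n : 0 < n
    0<n = ≤-trans (s≤s z≤n) 6≤n

  -- Divided by 4c(q + 1), the conclusion reads x/c < 1/4 + 1/(q + 1). After scaling by 36 the
  -- errors come to at most 10n³ ≤ 120c, below the permitted 36 * 4c = 144c.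
  ratio-upper : ∀ x → k * (24 * x) ≤ (k + 9) * (n * (n * n)) → 4 * x * suc q < c * suc q + 4 * c
  ratio-upper x upper = *-cancelˡ-< 36 _ _ (begin-strict
    36 * (4 * x * suc q)                                ≡⟨ lhs x (suc q) ⟩
    k * (24 * x)                                        ≤⟨ upper ⟩
    (k + 9) * (n * (n * n))                             ≡⟨ *-distribʳ-+ (n * (n * n)) k 9 ⟩
    k * (n * (n * n)) + 9 * (n * (n * n))               ≤⟨ +-monoˡ-≤ _ (*-monoʳ-≤ k (cube≤6C 6≤n)) ⟩
    k * (6 * c + 3 * (n * n)) + 9 * (n * (n * n))       ≡⟨ cong (_+ 9 * (n * (n * n))) (split k c (n * n)) ⟩
    6 * (k * c) + 3 * k * (n * n) + 9 * (n * (n * n))   ≤⟨ +-monoˡ-≤ _ (+-monoʳ-≤ (6 * (k * c))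
                                                             (≤-trans (*-monoˡ-≤ (n * n) (*-monoˡ-≤ k {3} {17} (m≤m+n 3 14)))
                                                               17kn²≤n³)) ⟩
    6 * (k * c) + n * (n * n) + 9 * (n * (n * n))       ≡⟨ join (6 * (k * c)) (n * (n * n)) ⟩
    6 * (k * c) + 10 * (n * (n * n))                    ≤⟨ +-monoʳ-≤ (6 * (k * c)) (*-monoʳ-≤ 10 (cube≤12C 6≤n)) ⟩
    6 * (k * c) + 10 * (12 * c)                         <⟨ +-monoʳ-< (6 * (k * c)) (begin-strict
      10 * (12 * c)  ≡⟨ *-assoc 10 12 c ⟨
      120 * c        <⟨ *-monoˡ-< c {{>-nonZero C>0}} {120} {144} (m≤m+n 121 23) ⟩
      144 * c        ∎) ⟩
    6 * (k * c) + 144 * c                               ≡⟨ rhs (suc q) c ⟩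
    36 * (c * suc q + 4 * c)                            ∎)
    where
    open ≤-Reasoning
    lhs : ∀ x q → 36 * (4 * x * q) ≡ 6 * q * (24 * x)
    lhs = solve-∀
    split : ∀ k c s → k * (6 * c + 3 * s) ≡ 6 * (k * c) + 3 * k * s
    split = solve-∀
    join : ∀ a b → a + b + 9 * b ≡ a + 10 * b
    join = solve-∀
    rhs : ∀ q c → 6 * (6 * q * c) + 144 * c ≡ 36 * (c * q + 4 * c)
    rhs = solve-∀

  -- The opposite side, x/c > 1/4 - 1/(q + 1): the error is 17kn² ≤ n³ ≤ 12c, again against 144c.
  ratio-lower : ∀ x → n * (n * n) ≤ 24 * x + 17 * (n * n) → c * suc q < 4 * x * suc q + 4 * c
  ratio-lower x lower = *-cancelˡ-< 36 _ _ (begin-strict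
    36 * (c * suc q)                                    ≡⟨ lhs c (suc q) ⟩
    k * (6 * c)                                         ≤⟨ *-monoʳ-≤ k (6C≤cube 6≤n) ⟩
    k * (n * (n * n))                                   ≤⟨ *-monoʳ-≤ k lower ⟩
    k * (24 * x + 17 * (n * n))                         ≡⟨ split k x (n * n) ⟩
    k * (24 * x) + 17 * k * (n * n)                     ≤⟨ +-monoʳ-≤ (k * (24 * x)) (≤-trans 17kn²≤n³ (cube≤12C 6≤n)) ⟩
    k * (24 * x) + 12 * c                               <⟨ +-monoʳ-< (k * (24 * x))
                                                             (*-monoˡ-< c {{>-nonZero C>0}} {12} {144} (m≤m+n 13 131)) ⟩
    k * (24 * x) + 144 * c                              ≡⟨ rhs (suc q) x c ⟩
    36 * (4 * x * suc q + 4 * c)                        ∎)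
    where
    open ≤-Reasoning
    lhs : ∀ c q → 36 * (c * q) ≡ 6 * q * (6 * c)
    lhs = solve-∀
    split : ∀ k x s → k * (24 * x + 17 * s) ≡ k * (24 * x) + 17 * k * s
    split = solve-∀
    rhs : ∀ q x c → 6 * q * (24 * x) + 144 * c ≡ 36 * (4 * x * q + 4 * c)
    rhs = solve-∀

∸-< : ∀ {x y r} → x ≤ y → y < x + r → y ℕ.∸ x < r
∸-< {x} {y} {r} x≤y y<x+r = m<n+o⇒m∸n<o y x {{>-nonZero (+-cancelˡ-< x 0 r
  (≤-<-trans (≤-trans (≤-reflexive (+-identityʳ x)) x≤y) y<x+r))}} y<x+r

∣⊖∣*-< : ∀ {a b q r} → a * q < b * q + r → b * q < a * q + r → ℤ.∣ a ℤ.⊖ b ∣ * q < r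
∣⊖∣*-< {a} {b} {q} upper lower with ≤-total a b
... | inj₁ a≤b rewrite ℤ.∣⊖∣-≤ a≤b | *-distribʳ-∸ q b a = ∸-< (*-monoˡ-≤ q a≤b) lower
... | inj₂ b≤a rewrite ℤ.∣m⊖n∣≡∣n⊖m∣ a b | ℤ.∣⊖∣-≤ b≤a | *-distribʳ-∸ q a b = ∸-< (*-monoˡ-≤ q b≤a) upper

-- The distance of x/c from 1/4 is |4x - c| / 4c, and ε is at least one over its denominator, so it
-- suffices that |4x - c| times that denominator is less than 4c.
ratio-close : ∀ x {c} p q-1 .(cop : Coprime (suc p) (suc q-1)) → 0 < c →
              4 * x * suc q-1 < c * suc q-1 + 4 * c → c * suc q-1 < 4 * x * suc q-1 + 4 * c →
              ℚ.∣ ratio x c ℚ.- (+ 1 / 4) ∣ ℚ.< mkℚ +[1+ p ] q-1 cop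
ratio-close x {suc d} p q-1 cop _ upper lower = ℚ.toℚᵘ-cancel-< (ℚᵘ.<-respˡ-≃ (ℚᵘ.≃-sym unnormalise) (*<* (begin-strict
  + ℤ.∣ + x ℤ.* + 4 ℤ.+ ℤ.- (+ 1) ℤ.* + suc d ∣ ℤ.* + suc q-1
    ≡⟨ cong (λ z → + ℤ.∣ z ∣ ℤ.* + suc q-1) numerator ⟩
  + ℤ.∣ (4 * x) ℤ.⊖ suc d ∣ ℤ.* + suc q-1
    ≡⟨ ℤ.pos-* ℤ.∣ (4 * x) ℤ.⊖ suc d ∣ (suc q-1) ⟨
  + (ℤ.∣ (4 * x) ℤ.⊖ suc d ∣ * suc q-1)
    <⟨ ℤ.+<+ (<-≤-trans (∣⊖∣*-< {4 * x} {suc d} {suc q-1} upper lower)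
         (≤-trans (≤-reflexive (*-comm 4 (suc d))) (m≤n*m (suc d * 4) (suc p)))) ⟩
  + (suc p * (suc d * 4))
    ≡⟨ ℤ.pos-* (suc p) (suc d * 4) ⟩
  + suc p ℤ.* + (suc d * 4) ∎)))
  where
  open ℤ.≤-Reasoning
  numerator : + x ℤ.* + 4 ℤ.+ ℤ.- (+ 1) ℤ.* + suc d ≡ (4 * x) ℤ.⊖ suc d
  numerator = trans (cong₂ ℤ._+_ (trans (sym (ℤ.pos-* x 4)) (cong +_ (*-comm x 4))) (ℤ.-1*i≡-i (+ suc d)))
    (ℤ.m-n≡m⊖n (4 * x) (suc d))
  -- Among unnormalised rationals the difference keeps the denominator `suc d * 4`, with no common
  -- factors cancelled.
  unnormalise : toℚᵘ ℚ.∣ ratio x (suc d) ℚ.- (+ 1 / 4) ∣ ℚᵘ.≃ ℚᵘ.∣ mkℚᵘ (+ x) d ℚᵘ.- mkℚᵘ (+ 1) 3 ∣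
  unnormalise = ℚᵘ.≃-trans (ℚ.toℚᵘ-homo-∣-∣ (ratio x (suc d) ℚ.- (+ 1 / 4))) (ℚᵘ.∣-∣-cong
    (ℚᵘ.≃-trans (ℚ.toℚᵘ-homo-+ (ratio x (suc d)) (ℚ.- (+ 1 / 4)))
      (ℚᵘ.+-congˡ (toℚᵘ (ℚ.- (+ 1 / 4))) (ℚ.toℚᵘ-fromℚᵘ (mkℚᵘ (+ x) d)))))

theorem1p1 : (ex : ℕ → ℕ) → (∀ n → IsEx C5minus n (ex n)) →
    ConvergesTo (λ n → ratio (ex n) (n C 3)) (+ 1 / 4)
theorem1p1 ex isEx (mkℚ (+ 0)    _   _)   (ℚ.*<* (ℤ.+<+ ()))
theorem1p1 ex isEx (mkℚ -[1+ _ ] _   _)   (ℚ.*<* ())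
-- The threshold 17k³ yields both 17k ≤ n, for the estimates against `n C 3`, and k³ ≤ n, for
-- `edge-upper`.
theorem1p1 ex isEx (mkℚ +[1+ p ] q-1 cop) _ = 17 * k * (k * k) , λ n N≤n → close n N≤n
  where
  k : ℕ
  k = 6 * suc q-1
  6≤k : 6 ≤ k
  6≤k = *-monoʳ-≤ 6 {1} (s≤s z≤n)
  close : ∀ n → 17 * k * (k * k) ≤ n → _
  -- The extremal graph itself obeys the upper bound, and comparing it with `nestedGraph n` gives
  -- the lower one.
  close n N≤n with (G , free , eG≡ex) , maximal ← isEx n =
    ratio-close (ex n) p q-1 cop (C>0 n q-1 17k≤n)
      (ratio-upper n q-1 17k≤n (ex n) (subst (λ x → k * (24 * x) ≤ (k + 9) * (n * (n * n))) eG≡ex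
        (edge-upper k (≤-trans (s≤s (s≤s z≤n)) 6≤k) k³≤n G free)))
      (ratio-lower n q-1 17k≤n (ex n) (≤-trans (edge-lower n)
        (+-monoˡ-≤ _ (*-monoʳ-≤ 24 (maximal (nestedGraph n) (nestedGraph-free n))))))
    where
    17k≤n : 17 * k ≤ n
    17k≤n = ≤-trans (m≤m*n (17 * k) (k * k) {{m*n≢0 k k}}) N≤n
    k³≤n : k * k * k ≤ n
    k³≤n = ≤-trans (≤-reflexive (*-assoc k k k)) (≤-trans (*-monoˡ-≤ (k * k) (m≤n*m k 17)) N≤n)
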